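{- For every parity game $\mathcal G$, the Lehtinen number of $\mathcal G$ is no larger than the Strahler number of $\mathcal G$.
   Context: **Parity games.** A parity game $\mathcal G$ consists of a finite directed graph $(V,E)$ in which every vertex has at least one outgoing edge, a partition $(V_{\mathrm{Even}},V_{\mathrm{Odd}})$ of $V$ (vertices owned by the players Steven and Audrey, respectively), and a priority function $\pi:V\to\{0,1,\dots,d\}$. Throughout $d$ is a fixed even integer that is at least every priority. A cycle is even if the highest vertex priority on it is even, and odd otherwise. For $S\subseteq V$, $\mathcal G\cap S$ is the substructure induced by $S$, and $\mathcal G\setminus S=\mathcal G\cap(V\setminus S)$. A (positional) Steven strategy is a set $\sigma\subseteq E$ such that every $v\in V_{\mathrm{Even}}$ has some $(v,u)\in\sigma$, and for every $v\in V_{\mathrm{Odd}}$ all edges $(v,u)\in E$ are in $\sigma$. It traps Audrey in a non-empty set $R$ if $w\in R$ and $(w,u)\in\sigma$ imply $u\in R$; $R$ is a trap for Audrey if some Steven strategy traps Audrey in $R$. A Steven dominion strategy on $D$ is a Steven strategy $\sigma$ that traps Audrey in $D$ and such that every cycle of $(D,\sigma)$ is even; $D$ is then a Steven dominion. The notions for Audrey are defined by swapping the roles of the players (and even/odd). The largest Steven (Audrey) dominion is the union of all Steven (Audrey) dominions (possibly empty). **Attractor decompositions.** The Steven attractor to a set $B$ in a game is the largest set $A\supseteq B$ for which there is a Steven strategy $\sigma$ such that every infinite path in $(V,\sigma)$ starting in $A$ visits $B$. For an even $d\ge 0$ and a (possibly empty) game $\mathcal G$ with all priorities at most $d$, a Steven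 $d$-attractor decomposition of $\mathcal G$ is a tuple $\mathcal H=\langle A,(S_1,\mathcal H_1,A_1),\dots,(S_\ell,\mathcal H_\ell,A_\ell)\rangle$, $\ell\ge 0$ (with $\ell=0$ if $d=0$), such that $A$ is the Steven attractor in $\mathcal G$ to the set of vertices of priority $d$ and, with $\mathcal G_1=\mathcal G\setminus A$, for each $i=1,\dots,\ell$: $S_i$ is a non-empty trap for Audrey in $\mathcal G_i$ in which all priorities are at most $d-2$; $\mathcal H_i$ is a Steven $(d-2)$-attractor decomposition of $\mathcal G\cap S_i$; $A_i$ is the Steven attractor to $S_i$ in $\mathcal G_i$; $\mathcal G_{i+1}=\mathcal G_i\setminus A_i$; and $\mathcal G_{\ell+1}$ is empty. A Steven attractor decomposition is a Steven $d$-attractor decomposition for some even $d$. Audrey attractor decompositions are defined analogously, swapping the roles of the players (and using odd bounds on priorities). **Strahler numbers.** Ordered trees: the trivial tree $\langle\rangle$ is an ordered tree, and so is $\langle T_1,\dots,T_\ell\rangle$ for ordered trees $T_1,\dots,T_\ell$ ($\ell\ge 1$). $\mathrm{Str}(\langle\rangle)=1$ and, for $T=\langle T_1,\dots,T_\ell\rangle$ with $m=\max_i\mathrm{Str}(T_i)$, $\mathrm{Str}(T)=m$ if there is a unique $i$ with $\mathrm{Str}(T_i)=m$ and $\mathrm{Str}(T)=m+1$ otherwise. The tree of $\mathcal H=\langle A,(S_1,\mathcal H_1,A_1),\dots,(S_\ell,\mathcal H_\ell,A_\ell)\rangle$ is $T_{\mathcal H}=\langle T_{\mathcal H_1},\dots,T_{\mathcal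 H_\ell}\rangle$ (trivial if $\ell=0$), and $\mathrm{Str}(\mathcal H)=\mathrm{Str}(T_{\mathcal H})$. The Strahler number of a parity game is the maximum of the smallest Strahler number of a Steven attractor decomposition of the subgame induced by its largest Steven dominion and the smallest Strahler number of an Audrey attractor decomposition of the subgame induced by its largest Audrey dominion. **Register games.** For $k\ge 1$, the $k$-register game $\mathcal R^k(\mathcal G)$ is the parity game with states, moves and ranks (as its vertices, edges and priorities) as follows. States are pairs $(v,\langle r_k,\dots,r_1\rangle)$, of rank $1$ and owned by Steven, and triples $(v,\langle r_k,\dots,r_1\rangle,p)$, of rank $p$ and owned by the owner of $v$, where $v\in V$, $d\ge r_k\ge\cdots\ge r_1\ge 0$, $1\le p\le 2k+1$. At $(v,\langle r_k,\dots,r_1\rangle)$ Steven picks $i\in\{0,\dots,k\}$, moving to $(v,\langle r'_k,\dots,r'_{i+1},r'_i,0,\dots,0\rangle,p)$, where $r'_j=\max(r_j,\pi(v))$ for $j\ge i+1$, $r'_i=\pi(v)$ (if $i\ge 1$), and $p=2i$ if $i\ge 1$ and $\max(r_i,\pi(v))$ is even, and $p=2i+1$ if $i=0$, or if $i\ge 1$ and $\max(r_i,\pi(v))$ is odd. At $(v,\langle r_k,\dots,r_1\rangle,p)$ the owner of $v$ picks an edge $(v,u)\in E$, moving to $(u,\langle r_k,\dots,r_1\rangle)$. A Steven defensive dominion strategy in $\mathcal R^k(\mathcal G)$ is a Steven dominion strategy in $\mathcal R^k(\mathcal G)$ on a set of states containing no state of rank $2k+1$. The Lehtinen number of a Steven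 dominion $D$ in $\mathcal G$ is the smallest $k\ge 1$ such that Steven has a defensive dominion strategy in $\mathcal R^k(\mathcal G)$ on a set of states that includes all states $(v,\langle r_k,\dots,r_1\rangle)$ with $v\in D$ and $r_k$ an even number at least as large as every vertex priority in $D$. The Lehtinen number of $\mathcal G$ is the Lehtinen number of its largest Steven dominion (taken to be $1$ if that dominion is empty). -}

module Defs where

open import Data.Bool.Base using (Bool; true; T; not; _∧_)
open import Data.Fin.Base using (Fin; zero; suc; toℕ)
open import Data.List.Base using (List; []; _∷_; _++_; [_]; map; length; filter)
open import Data.List.Extrema.Nat using (max)
open import Data.List.Relation.Unary.All using (All)
open import Data.List.Relation.Unary.Linked using (Linked)
open import Data.List.Relation.Unary.Unique.Propositional using (Unique)
open import Data.Nat.Base using (ℕ; zero; suc; _+_; _*_; _≤_; _⊔_; _≡ᵇ_; parity)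
open import Data.Nat.Properties using (_≟_; _≤?_; <-cmp)
open import Data.Parity.Base using (Parity; 0ℙ; 1ℙ)
open import Data.Product.Base using (Σ; Σ-syntax; ∃-syntax; _×_; _,_)
open import Data.Sum.Base using (_⊎_)
open import Data.Empty using (⊥)
open import Data.Vec.Base using (Vec; lookup; tabulate; last)
import Data.Vec.Relation.Unary.All as VecAll
import Data.Vec.Relation.Unary.Linked as VecLinked
open import Function.Bundles using (_⇔_)
open import Relation.Binary.Definitions using (tri<; tri≈; tri>)
open import Relation.Binary.PropositionalEquality.Core using (_≡_; _≢_)
open import Relation.Nullary.Decidable using (Dec; ⌊_⌋; _×-dec_; yes; no)
open import Relation.Nullary.Negation.Core using (¬_)

Minimum : (ℕ → Set) → ℕ → Set
Minimum P m = P m × (∀ j → P j → m ≤ j)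

data Player : Set where
  steven audrey : Player

parityOf : Player → Parity
parityOf steven = 0ℙ
parityOf audrey = 1ℙ

-- All games here are finite, so sets of vertices and of edges are decidable.

Subset : Set → Set
Subset X = X → Bool

infix 4 _∈_ _⊆_

_∈_ : ∀ {X} → X → Subset X → Set
x ∈ S = T (S x)

_⊆_ : ∀ {X} → Subset X → Subset X → Set
S ⊆ S′ = ∀ v → v ∈ S → v ∈ S′

Empty Nonempty : ∀ {X} → Subset X → Set
Empty S    = ∀ v → ¬ (v ∈ S)
Nonempty S = ∃[ v ] v ∈ S

_∖_ : ∀ {X} → Subset X → Subset X → Subset X
(S ∖ S′) v = S v ∧ not (S′ v)

Strategy : Set → Set
Strategy X = X → X → Bool

-- The vertices are the members of V. Passing to an induced substructure
-- shrinks V and keeps the type Pos; nothing is required of the other fields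
-- outside V.

record Arena : Set₁ where
  field
    Pos      : Set
    V        : Subset Pos
    E        : Pos → Pos → Set
    owner    : Pos → Player
    priority : Pos → ℕ

  Edge : Pos → Pos → Set
  Edge v u = v ∈ V × u ∈ V × E v u

infixl 6 _∩_

_∩_ : (G : Arena) → Subset (Arena.Pos G) → Arena
G ∩ S = record G { V = λ v → Arena.V G v ∧ S v }

record ParityGame : Set where
  field
    n        : ℕ
    edge     : Fin n → Fin n → Bool
    total    : ∀ v → ∃[ u ] T (edge v u)
    owner    : Fin n → Player
    π        : Fin n → ℕ
    d        : ℕ
    d-even   : parity d ≡ 0ℙ
    π≤d      : ∀ v → π v ≤ d

  arena : Arena
  arena = record
    { Pos      = Fin n
    ; V        = λ _ → true
    ; E        = λ v u → T (edge v u)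
    ; owner    = owner
    ; priority = π
    }

module _ (G : Arena) (P : Player) where
  open Arena G

  record IsStrategy (σ : Strategy Pos) : Set where
    field
      edges    : ∀ v u → T (σ v u) → Edge v u
      own      : ∀ v → v ∈ V → owner v ≡ P → ∃[ u ] T (σ v u)
      opponent : ∀ v u → owner v ≢ P → Edge v u → T (σ v u)

  -- σ traps the opponent of P in R.
  record TrapsIn (σ : Strategy Pos) (R : Subset Pos) : Set where
    field
      inside   : R ⊆ V
      nonempty : Nonempty R
      closed   : ∀ w u → w ∈ R → T (σ w u) → u ∈ R

  -- R is a trap for the opponent of P.
  IsTrap : Subset Pos → Set
  IsTrap R = ∃[ σ ] IsStrategy σ × TrapsIn σ R

  -- The (simple) cycle v → v₁ → … → vₘ → v, where vs = v₁ … vₘ.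
  record IsCycle (σ : Strategy Pos) (D : Subset Pos) (v : Pos) (vs : List Pos) : Set where
    field
      inside : All (_∈ D) (v ∷ vs)
      simple : Unique (v ∷ vs)
      linked : Linked (λ w u → T (σ w u)) (v ∷ vs ++ [ v ])

  highest : List Pos → ℕ
  highest vs = max 0 (map priority vs)

  record IsDominionStrategy (σ : Strategy Pos) (D : Subset Pos) : Set where
    field
      strategy : IsStrategy σ
      traps    : TrapsIn σ D
      cycles   : ∀ v vs → IsCycle σ D v vs → parity (highest (v ∷ vs)) ≡ parityOf P

  IsDominion : Subset Pos → Set
  IsDominion D = ∃[ σ ] IsDominionStrategy σ D

  -- The union of all dominions.
  IsLargestDominion : Subset Pos → Set
  IsLargestDominion D = ∀ v → v ∈ D ⇔ (∃[ D′ ] IsDominion D′ × v ∈ D′)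

  record Forces (B A : Subset Pos) : Set where
    field
      inside : A ⊆ V
      target : B ⊆ A
      σ      : Strategy Pos
      isStr  : IsStrategy σ
      visits : ∀ (p : ℕ → Pos) → p 0 ∈ A → (∀ i → T (σ (p i) (p (suc i)))) →
               ∃[ i ] p i ∈ B

  -- A is the attractor of P to B.
  IsAttractor : Subset Pos → Subset Pos → Set
  IsAttractor B A = Forces B A × (∀ A′ → Forces B A′ → A′ ⊆ A)

-- Decomposition d U is the type of d-attractor decompositions of G ∩ U by P;
-- Layers d U is the type of sequences (Sᵢ , ℋᵢ , Aᵢ)ᵢ where 𝒢₁ = G ∩ U.
-- A nonempty S never has all priorities at most d - 2 when d < 2, so then
-- only the empty sequence is available.

module _ (G : Arena) (P : Player) where
  open Arena G

  withPriority : ℕ → Subset Pos → Subset Pos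
  withPriority d U v = (V v ∧ U v) ∧ (priority v ≡ᵇ d)

  data Decomposition (d : ℕ) (U : Subset Pos) : Set
  data Layers : ℕ → Subset Pos → Set

  data Decomposition d U where
    decomposition :
      parity d ≡ parityOf P →
      (∀ v → v ∈ Arena.V (G ∩ U) → priority v ≤ d) →
      (A : Subset Pos) →
      IsAttractor (G ∩ U) P (withPriority d U) A →
      Layers d (U ∖ A) →
      Decomposition d U

  data Layers where
    done  : ∀ {d U} → Empty (Arena.V (G ∩ U)) → Layers d U
    layer : ∀ {d U}
      (S : Subset Pos) →
      IsTrap (G ∩ U) P S →
      (∀ v → v ∈ S → priority v ≤ d) →
      Decomposition d S →
      (A : Subset Pos) →
      IsAttractor (G ∩ U) P S A →
      Layers (2 + d) (U ∖ A) →
      Layers (2 + d) U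

data Tree : Set where
  node : List Tree → Tree

strahlerAbove : List ℕ → ℕ
strahlerAbove ns with max 0 ns
... | m with length (filter (_≟ m) ns) ≟ 1
...   | yes _ = m
...   | no  _ = suc m

strahler  : Tree → ℕ
strahlers : List Tree → List ℕ

strahler (node [])       = 1
strahler (node (t ∷ ts)) = strahlerAbove (strahler t ∷ strahlers ts)

strahlers []       = []
strahlers (t ∷ ts) = strahler t ∷ strahlers ts

module _ {G : Arena} {P : Player} where

  tree  : ∀ {d U} → Decomposition G P d U → Tree
  trees : ∀ {d U} → Layers G P d U → List Tree

  tree (decomposition _ _ _ _ ls) = node (trees ls)

  trees (done _)              = []
  trees (layer _ _ _ H _ _ ls) = tree H ∷ trees ls

-- s is the smallest Strahler number of an attractor decomposition of G ∩ D by P.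
IsSmallestStrahler : (G : Arena) → Player → Subset (Arena.Pos G) → ℕ → Set
IsSmallestStrahler G P D =
  Minimum λ s → ∃[ d ] Σ[ H ∈ Decomposition G P d D ] strahler (tree H) ≡ s

IsStrahlerNumber : ParityGame → ℕ → Set
IsStrahlerNumber 𝒢 s =
  ∃[ Dˢ ] ∃[ Dᵃ ] ∃[ sˢ ] ∃[ sᵃ ]
    IsLargestDominion G steven Dˢ × IsSmallestStrahler G steven Dˢ sˢ ×
    IsLargestDominion G audrey Dᵃ × IsSmallestStrahler G audrey Dᵃ sᵃ ×
    s ≡ sˢ ⊔ sᵃ
  where G = ParityGame.arena 𝒢

module RegisterGame (𝒢 : ParityGame) (k : ℕ) where
  open ParityGame 𝒢 using (n; π; d) renaming (arena to G)

  -- ⟨ r_k , … , r₁ ⟩ with r₁ stored first: index i : Fin k is register i + 1.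
  Registers : Set
  Registers = Vec ℕ k

  Valid : Registers → Set
  Valid r = VecLinked.Linked _≤_ r × VecAll.All (_≤ d) r

  valid? : ∀ r → Dec (Valid r)
  valid? r = VecLinked.linked? _≤?_ r ×-dec VecAll.all? (_≤? d) r

  data State : Set where
    choose : Fin n → Registers → State
    move   : Fin n → Registers → ℕ → State

  states : Subset State
  states (choose v r) = ⌊ valid? r ⌋
  states (move v r p) = ⌊ valid? r ×-dec (1 ≤? p ×-dec p ≤? (2 * k + 1)) ⌋

  -- The registers after Steven picks i at a vertex of priority q.
  update : Fin (suc k) → ℕ → Registers → Registers
  update i q r = tabulate new
    where
    new : Fin k → ℕ
    new j with <-cmp (suc (toℕ j)) (toℕ i)
    ... | tri< _ _ _ = 0
    ... | tri≈ _ _ _ = q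
    ... | tri> _ _ _ = lookup r j ⊔ q

  rankOfChoice : Fin (suc k) → ℕ → Registers → ℕ
  rankOfChoice zero    q r = 1
  rankOfChoice (suc i) q r with parity (lookup r i ⊔ q)
  ... | 0ℙ = 2 * suc (toℕ i)
  ... | 1ℙ = 2 * suc (toℕ i) + 1

  data _⟶_ : State → State → Set where
    pick : ∀ v r i →
      choose v r ⟶ move v (update i (π v) r) (rankOfChoice i (π v) r)
    step : ∀ v u r p → Arena.Edge G v u →
      move v r p ⟶ choose u r

  stateOwner : State → Player
  stateOwner (choose v r) = steven
  stateOwner (move v r p) = Arena.owner G v

  rank : State → ℕ
  rank (choose v r) = 1
  rank (move v r p) = p

  arena : Arena
  arena = record
    { Pos      = State
    ; V        = states
    ; E        = _⟶_
    ; owner    = stateOwner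
    ; priority = rank
    }

  record IsDefensive (σ : Strategy State) (W : Subset State) : Set where
    field
      dominion  : IsDominionStrategy arena steven σ W
      defensive : ∀ s → s ∈ W → rank s ≢ 2 * k + 1

-- There is no 0-register game, so the numbers k considered are at least 1.
HasDefensiveOn : (𝒢 : ParityGame) → Subset (Fin (ParityGame.n 𝒢)) → ℕ → Set
HasDefensiveOn 𝒢 D zero    = ⊥
HasDefensiveOn 𝒢 D (suc m) =
  ∃[ σ ] ∃[ W ] IsDefensive σ W ×
    (∀ v r → v ∈ D → Valid r →
     parity (last r) ≡ 0ℙ → (∀ u → u ∈ D → π u ≤ last r) →
     choose v r ∈ W)
  where
  open ParityGame 𝒢 using (π)
  open RegisterGame 𝒢 (suc m)

IsLehtinenNumber : ParityGame → ℕ → Set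
IsLehtinenNumber 𝒢 ℓ =
  ∃[ D ] IsLargestDominion (ParityGame.arena 𝒢) steven D ×
    ((Empty D × ℓ ≡ 1) ⊎ (Nonempty D × Minimum (HasDefensiveOn 𝒢 D) ℓ))

{-# OPTIONS --safe #-}

-- Steven wins defensively with a strategy of the register game in which both
-- the edge and the register to reset depend on the current vertex only. Given
-- a d-attractor decomposition of Strahler number at most k, he resets register
-- k at the vertices of priority d, resets nothing on the way to an attractor's
-- target, and recurses inside each Sᵢ, with k registers in the one whose
-- Strahler number is k, if any, and with k - 1 registers in the others.
--
-- A cycle either stays in a single Sᵢ or visits priority d, because Audrey can
-- leave Sᵢ only towards A and the earlier layers. In the latter case register
-- k is reset, and 2k + 1 must not occur. Call the content x of register k weak
-- if x ≤ d or x is even, and strong if x is even and bounds the priorities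
-- ahead. Weak is enough in A, where a reset compares x with d, and in the
-- layers before the one of Strahler number k, from which Audrey can only go
-- back towards A. In that layer and in the later ones x is strong until the
-- layer's own strategy takes over, since register k is not reset there. After
-- a visit to priority d the content is d, which is both.
--
-- Lehtinen numbers are minima, so it is also shown that having a defensive
-- strategy is decidable.

module Submission where

open import Data.Bool.Base using (Bool; T; _∧_; _∨_; false; if_then_else_; not; true)
open import Data.Bool.Properties using (T-∧; T-∨; T?)
open import Data.Empty using (⊥-elim)
open import Data.Fin.Base using (Fin; fromℕ<; suc; toℕ; zero)
import Data.Fin.Properties as Fin
import Data.Fin.Subset.Properties as Fin
open import Data.List.Base
  using (List; []; [_]; _++_; _∷_; allFin; cartesianProduct; cartesianProductWith; filter; length; map; upTo)
import Data.List.Base as List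
open import Data.List.Extrema.Nat using (max; max≤v⁺; v≤max⁺; xs≤max)
open import Data.List.Membership.Propositional using (find; lose) renaming (_∈_ to _∈ˡ_)
open import Data.List.Membership.Propositional.Properties
  using (∈-++⁺ʳ; ∈-++⁺ˡ; ∈-allFin; ∈-cartesianProductWith⁺; ∈-cartesianProduct⁺;
         ∈-cartesianProduct⁻; ∈-lookup; ∈-upTo⁺)
open import Data.List.Properties using (filter-accept; filter-reject)
open import Data.List.Relation.Unary.All as All using (All; []; _∷_)
import Data.List.Relation.Unary.All.Properties as All
open import Data.List.Relation.Unary.AllPairs using ([]; _∷_)
open import Data.List.Relation.Unary.Any as Any using (Any; here; there)
import Data.List.Relation.Unary.Any.Properties as Any
open import Data.List.Relation.Unary.Linked as Linked using (Linked; [-]; _∷_)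
import Data.List.Relation.Unary.Unique.DecPropositional as DecUnique
open import Data.List.Relation.Unary.Unique.Propositional using (Unique)
open import Data.Nat.Base
  using (_*_; _+_; _<_; _≤_; _⊓_; _⊔_; parity; suc; s≤s; s≤s⁻¹; zero; z≤n; ℕ)
open import Data.Nat.DivMod
  using ([m+kn]%n≡m%n; [m+n]%n≡m%n; _%_; _/_; m%n<n; m<n⇒m%n≡m; m≡m%n+[m/n]*n; n%n≡0)
open import Data.Nat.Properties
open import Data.Parity.Base using (0ℙ; 1ℙ)
import Data.Parity.Properties as ℙ
open import Data.Product.Base using (_,_; _×_; curry; proj₁; proj₂; uncurry; ∃-syntax)
open import Data.Product.Properties using () renaming (≡-dec to ×-≡-dec)
open import Data.Sum.Base using (_⊎_; inj₁; inj₂)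
open import Data.Unit.Base using (tt; ⊤)
open import Data.Vec.Base using (Vec; []; _∷_; last; lookup; replicate; tabulate)
import Data.Vec.Properties as Vec
import Data.Vec.Relation.Unary.All as VecAll
import Data.Vec.Relation.Unary.All.Properties as VecAll
import Data.Vec.Relation.Unary.Linked as VecLinked
import Data.Vec.Relation.Unary.Linked.Properties as VecLinked
open import Defs
open import Function.Base using (_∘_)
open import Function.Bundles using (Equivalence)
open import Relation.Binary.Definitions using (DecidableEquality; tri<; tri>; tri≈)
open import Relation.Binary.PropositionalEquality hiding ([_])
open import Relation.Nullary.Decidable
  using (Dec; _×-dec_; _→-dec_; _⊎-dec_; fromWitness; map′; no; toWitness; yes; ¬?; ⌊_⌋)
open import Relation.Nullary.Negation.Core using (contradiction; ¬_)

-- Booleans, set difference, parities and periodic properties.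

if-true : ∀ {a} {X : Set a} {x y : X} b → T b → (if b then x else y) ≡ x
if-true true _ = refl

if-false : ∀ {a} {X : Set a} {x y : X} b → ¬ T b → (if b then x else y) ≡ y
if-false false _ = refl
if-false true h  = contradiction tt h

module _ {X : Set} (S S′ : Subset X) {v : X} where

  ∈-∖ : v ∈ S → ¬ (v ∈ S′) → v ∈ (S ∖ S′)
  ∈-∖ v∈S v∉S′ with S v | S′ v
  ... | true | false = tt
  ... | true | true  = v∉S′ tt

  ∖⇒∈ : v ∈ (S ∖ S′) → v ∈ S
  ∖⇒∈ h with S v
  ... | true = tt

  ∖⇒∉ : v ∈ (S ∖ S′) → ¬ (v ∈ S′)
  ∖⇒∉ h with S v | S′ v
  ... | true | false = λ ()

steven? : ∀ P → Dec (P ≡ steven)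
steven? steven = yes refl
steven? audrey = no λ ()

parity-double : ∀ c → parity (2 * c) ≡ 0ℙ
parity-double zero    = refl
parity-double (suc c) rewrite +-suc c (c + 0) = parity-double c

⊔-even : ∀ x y → parity x ≡ 0ℙ → parity y ≡ 0ℙ → parity (x ⊔ y) ≡ 0ℙ
⊔-even x y px py with ⊔-sel x y
... | inj₁ eq = trans (cong parity eq) px
... | inj₂ eq = trans (cong parity eq) py

-- For properties of the times of a play with period `suc N`. Any time `t` is reached from `s` by
-- stepping forward to a whole number of periods after `t` and then rewinding; a search need only
-- look at the remainders modulo `suc N`.
module Periodic (Q : ℕ → Set) (N : ℕ) (back : ∀ t → Q (t + suc N) → Q t) where

  rewind : ∀ m t → Q (t + m * suc N) → Q t
  rewind zero    t q = subst Q (+-identityʳ t) q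
  rewind (suc m) t q = back t (rewind m (t + suc N) (subst Q (sym (+-assoc t (suc N) (m * suc N))) q))

  persists : (∀ t → Q t → Q (suc t)) → ∀ {s} → Q s → ∀ t → Q t
  persists next {s} q t = rewind s t (subst Q eq (later (t + s * N)))
    where
    later : ∀ j → Q (j + s)
    later zero    = q
    later (suc j) = next _ (later j)
    eq : t + s * N + s ≡ t + s * suc N
    eq = trans (+-assoc t (s * N) s) (cong (t +_) (trans (+-comm (s * N) s) (sym (*-suc s N))))

  search : (∀ t → Dec (Q t)) → (∃[ t ] Q t) ⊎ (∀ t → ¬ Q t)
  search Q? with anyUpTo? Q? (suc N)
  ... | yes (t , _ , q) = inj₁ (t , q)
  ... | no none = inj₂ λ t q → none
    (t % suc N , m%n<n t (suc N) , rewind (t / suc N) _ (subst Q (m≡m%n+[m/n]*n t (suc N)) q))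

-- Strahler numbers of sequences of subtrees.

-- At most one entry is `k` and the others are smaller, in the shape that the recursion over layers
-- needs: `big∷` marks the one layer allowed to use all `k` registers, `small∷` passes over a layer
-- in front, and `small` means that no such layer remains.
data Fit (k : ℕ) : List ℕ → Set where
  small   : ∀ {ns} → All (_< k) ns → Fit k ns
  small∷ : ∀ {n ns} → n < k → Fit k ns → Fit k (n ∷ ns)
  big∷   : ∀ {n ns} → n ≤ k → All (_< k) ns → Fit k (n ∷ ns)

Fit-count : ∀ m ns → All (_≤ m) ns → length (filter (_≟ m) ns) ≤ 1 → Fit m ns
Fit-count m []       _            _ = small []
Fit-count m (n ∷ ns) (n≤m ∷ ns≤m) c with n ≟ m
... | no n≢m = small∷ (≤∧≢⇒< n≤m n≢m)
  (Fit-count m ns ns≤m (subst (λ l → length l ≤ 1) (filter-reject (_≟ m) n≢m) c))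
... | yes n≡m = big∷ n≤m
  (none ns ns≤m (s≤s⁻¹ (subst (λ l → length l ≤ 1) (filter-accept (_≟ m) n≡m) c)))
  where
  none : ∀ ns → All (_≤ m) ns → length (filter (_≟ m) ns) ≤ 0 → All (_< m) ns
  none []       _            _ = []
  none (n ∷ ns) (n≤m ∷ ns≤m) c with n ≟ m
  ... | no n≢m = ≤∧≢⇒< n≤m n≢m
    ∷ none ns ns≤m (subst (λ l → length l ≤ 0) (filter-reject (_≟ m) n≢m) c)
  ... | yes n≡m = contradiction (subst (λ l → length l ≤ 0) (filter-accept (_≟ m) n≡m) c) λ ()

Fit-mono : ∀ {m k ns} → m ≤ k → Fit m ns → Fit k ns
Fit-mono m≤k (small h)      = small (All.map (λ n<m → <-≤-trans n<m m≤k) h)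
Fit-mono m≤k (small∷ h f)  = small∷ (<-≤-trans h m≤k) (Fit-mono m≤k f)
Fit-mono m≤k (big∷ h hs)   = big∷ (≤-trans h m≤k) (All.map (λ n<m → <-≤-trans n<m m≤k) hs)

-- If the maximum occurs once, it is the value of `strahlerAbove` and its entry becomes the big one;
-- otherwise the value exceeds the maximum, so every entry is below `k`.
strahlerAbove-Fit : ∀ {k} ns → strahlerAbove ns ≤ k → Fit k ns
strahlerAbove-Fit ns h with length (filter (_≟ max 0 ns) ns) ≟ 1
... | yes c = Fit-mono h (Fit-count _ ns (xs≤max 0 ns) (≤-reflexive c))
... | no _  = small (All.map (λ n≤ → <-≤-trans (s≤s n≤) h) (xs≤max 0 ns))

strahler-Fit : ∀ {k} ts → strahler (node ts) ≤ k → Fit k (strahlers ts)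
strahler-Fit []       _ = small []
strahler-Fit (t ∷ ts) h = strahlerAbove-Fit _ h

max≤strahlerAbove : ∀ ns → max 0 ns ≤ strahlerAbove ns
max≤strahlerAbove ns with length (filter (_≟ max 0 ns) ns) ≟ 1
... | yes _ = ≤-refl
... | no _  = n≤1+n _

strahler≥1 : ∀ t → 1 ≤ strahler t
strahler≥1 (node [])       = ≤-refl
strahler≥1 (node (t ∷ ts)) =
  ≤-trans (strahler≥1 t) (≤-trans (All.head (xs≤max 0 ns)) (max≤strahlerAbove ns))
  where ns = strahler t ∷ strahlers ts

-- Ranks and the content of the top register.

rankOf : ℕ → ℕ → ℕ
rankOf zero    x = 1
rankOf (suc j) x with parity x
... | 0ℙ = 2 * suc j
... | 1ℙ = 2 * suc j + 1

rankOf-even : ∀ j x → parity x ≡ 0ℙ → rankOf (suc j) x ≡ 2 * suc j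
rankOf-even j x eq rewrite eq = refl

-- Even the odd rank `2 * j + 1` of a register below `k` is less than `2 * k`, so one even reset of
-- register `k` outweighs all of these.
rankOf-< : ∀ {j k} x → j < k → rankOf j x ≤ 2 * k
rankOf-< {zero}  x j<k = ≤-trans (s≤s z≤n) (*-monoʳ-≤ 2 j<k)
rankOf-< {suc j} {k} x j<k with parity x
... | 0ℙ = *-monoʳ-≤ 2 (<⇒≤ j<k)
... | 1ℙ = begin
  2 * suc j + 1     ≤⟨ +-monoʳ-≤ (2 * suc j) (s≤s z≤n) ⟩
  2 * suc j + 2     ≡⟨ +-comm (2 * suc j) 2 ⟩
  2 + 2 * suc j     ≡⟨ sym (*-suc 2 (suc j)) ⟩
  2 * suc (suc j)   ≤⟨ *-monoʳ-≤ 2 j<k ⟩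
  2 * k             ∎
  where open ≤-Reasoning

-- For even `w`, `Weak w x` makes `x ⊔ w` even; `Strong m` survives maxima with priorities up to
-- `m`.
Strong Weak : ℕ → ℕ → Set
Strong m x = parity x ≡ 0ℙ × m ≤ x
Weak   w x = x ≤ w ⊎ parity x ≡ 0ℙ

strong? : ∀ m x → Dec (Strong m x)
strong? m x = (parity x ℙ.≟ 0ℙ) ×-dec (m ≤? x)

weak? : ∀ w x → Dec (Weak w x)
weak? w x = (x ≤? w) ⊎-dec (parity x ℙ.≟ 0ℙ)

-- Updated k j q x y: register k, holding x, holds y after register j is reset
-- at a vertex of priority q.
data Updated (k j q x : ℕ) : ℕ → Set where
  kept     : j < k → Updated k j q x (x ⊔ q)
  assigned : j ≡ k → Updated k j q x q

Strong-⊔ : ∀ {m x} q → q ≤ m → Strong m x → Strong m (x ⊔ q)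
Strong-⊔ q q≤m (ev , m≤x) rewrite m≥n⇒m⊔n≡m (≤-trans q≤m m≤x) = ev , m≤x

Weak-Updated : ∀ {w k j q x y} → q ≤ w → parity w ≡ 0ℙ → Weak w x → Updated k j q x y → Weak w y
Weak-Updated q≤w _  _         (assigned _) = inj₁ q≤w
Weak-Updated q≤w _  (inj₁ x≤w) (kept _)    = inj₁ (⊔-lub x≤w q≤w)
Weak-Updated {w} {q = q} {x} q≤w ev (inj₂ px) (kept _) with ⊔-sel x q
... | inj₁ eq = inj₂ (trans (cong parity eq) px)
... | inj₂ eq = inj₁ (≤-trans (≤-reflexive eq) q≤w)

-- Traces, plans and guards.

module Strategies (𝒢 : ParityGame) where
  open ParityGame 𝒢 using (n; edge; owner; π) renaming (arena to G)

  private
    Vertex : Set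
    Vertex = Fin n
    VSet : Set
    VSet = Subset (Fin n)

  record Move (next : Vertex → Vertex) (v u : Vertex) : Set where
    constructor _,_
    field
      along  : T (edge v u)
      chosen : owner v ≡ steven → u ≡ next v

  Move-cong : ∀ {f g v u} → f v ≡ g v → Move f v u → Move g v u
  Move-cong eq (e , s) = e , λ o → trans (s o) eq

  by-owner : ∀ {X : Set} v → (owner v ≡ steven → X) → (¬ (owner v ≡ steven) → X) → X
  by-owner v f g with steven? (owner v)
  ... | yes o = f o
  ... | no ¬o = g ¬o

  -- A periodic play of the register game, one round per time step: register t j
  -- is the content of register j before the round, reset t the register chosen
  -- in it (0 for none).
  record Trace : Set where
    field
      period   : ℕ
      vertex   : ℕ → Vertex
      reset    : ℕ → ℕ
      register : ℕ → ℕ → ℕ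
      vertex-periodic   : ∀ t → vertex (t + suc period) ≡ vertex t
      register-periodic : ∀ t j → register (t + suc period) j ≡ register t j
      edges    : ∀ t → T (edge (vertex t) (vertex (suc t)))
      keeps    : ∀ t j → reset t < j → register (suc t) j ≡ register t j ⊔ π (vertex t)
      assigns  : ∀ t j → reset t ≡ suc j → register (suc t) (suc j) ≡ π (vertex t)

    rankAt : ℕ → ℕ
    rankAt t = rankOf (reset t) (register t (reset t) ⊔ π (vertex t))

    -- The highest rank that occurs is even, stated without computing a maximum over a period.
    EvenMax : Set
    EvenMax = ∃[ c ] (∀ t → rankAt t ≤ 2 * c) × ∃[ t ] rankAt t ≡ 2 * c

    visits? : (S : VSet) → (∃[ t ] vertex t ∈ S) ⊎ (∀ t → ¬ (vertex t ∈ S))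
    visits? S = Periodic.search (λ t → vertex t ∈ S) period
      (λ t → subst (_∈ S) (vertex-periodic t)) (λ t → T? (S (vertex t)))

    stays : (S : VSet) → (∀ t → vertex t ∈ S → vertex (suc t) ∈ S) →
            ∀ {s} → vertex s ∈ S → ∀ t → vertex t ∈ S
    stays S = Periodic.persists (λ t → vertex t ∈ S) period
      (λ t → subst (_∈ S) (vertex-periodic t))

  record Obeys (U : VSet) (f : Vertex → Vertex) (ρ : Vertex → ℕ) (τ : Trace) : Set where
    open Trace τ
    field
      inside  : ∀ t → vertex t ∈ U
      follows : ∀ t → owner (vertex t) ≡ steven → vertex (suc t) ≡ f (vertex t)
      resets  : ∀ t → reset t ≡ ρ (vertex t)

    moves : ∀ t → Move f (vertex t) (vertex (suc t))
    moves t = edges t , follows t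

  Obeys-restrict : ∀ {U U′ f f′ ρ ρ′ τ} → (∀ t → Trace.vertex τ t ∈ U′) →
                   (∀ v → v ∈ U′ → f v ≡ f′ v) → (∀ v → v ∈ U′ → ρ v ≡ ρ′ v) →
                   Obeys U f ρ τ → Obeys U′ f′ ρ′ τ
  Obeys-restrict ins f≗f′ ρ≗ρ′ ob = record
    { inside  = ins
    ; follows = λ t o → trans (follows t o) (f≗f′ _ (ins t))
    ; resets  = λ t → trans (resets t) (ρ≗ρ′ _ (ins t))
    }
    where open Obeys ob

  -- The vertices outside U are irrelevant: next and reset are junk there.
  record Plan (U : VSet) (k : ℕ) : Set where
    field
      next        : Vertex → Vertex
      reset       : Vertex → ℕ
      next-edge   : ∀ {v} → v ∈ U → owner v ≡ steven → T (edge v (next v))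
      next-inside : ∀ {v} → v ∈ U → owner v ≡ steven → next v ∈ U
      reset≤      : ∀ {v} → v ∈ U → reset v ≤ k
      even        : ∀ τ → Obeys U next reset τ → Trace.EvenMax τ

  weaken : ∀ {U k k′} → k ≤ k′ → Plan U k → Plan U k′
  weaken k≤k′ P = record
    { next = next ; reset = reset ; next-edge = next-edge ; next-inside = next-inside
    ; reset≤ = λ v∈U → ≤-trans (reset≤ v∈U) k≤k′ ; even = even }
    where open Plan P

  -- An invariant on the content x of register k along the plays in U, under
  -- which resetting register k never has an odd outcome.
  record Guard (U : VSet) (k : ℕ) (next : Vertex → Vertex) (reset : Vertex → ℕ) (m w : ℕ) : Set₁ where
    field
      Good        : Vertex → ℕ → Set
      good?       : ∀ v x → Dec (Good v x)
      strong⇒good : ∀ {v x} → v ∈ U → Strong m x → Good v x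
      good⇒weak   : ∀ {v x} → v ∈ U → Good v x → Weak w x
      good-step   : ∀ {v u x y} → v ∈ U → u ∈ U → Move next v u → Good v x →
                    Updated k (reset v) (π v) x y → Good u y
      good-even   : ∀ {v x} → v ∈ U → reset v ≡ k → Good v x → parity (x ⊔ π v) ≡ 0ℙ

  -- The bounds `m` and `w` are the interface between nested pieces: a play may enter with any
  -- content strong for `m`, and whenever it leaves, the content is weak for `w`.
  record GuardedPlan (U : VSet) (k m w : ℕ) : Set₁ where
    constructor _,_
    field
      plan  : Plan U k
      guard : Guard U k (Plan.next plan) (Plan.reset plan) m w

  -- A plan for `k` registers never resets register `suc k`, so a strong content there stays strong
  -- and `good-even` is vacuous.
  guardUnreset : ∀ {U k m w} → (∀ {v} → v ∈ U → π v ≤ m) → Plan U k → GuardedPlan U (suc k) m w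
  guardUnreset {U} {k} {m} π≤m P = weaken (n≤1+n _) P , record
    { Good        = λ _ → Strong m
    ; good?       = λ _ → strong? m
    ; strong⇒good = λ _ s → s
    ; good⇒weak   = λ _ s → inj₂ (proj₁ s)
    ; good-step   = λ
      { v∈U _ _ s (kept _)     → Strong-⊔ _ (π≤m v∈U) s
      ; v∈U _ _ s (assigned e) → contradiction e (<⇒≢ (reset<k v∈U))
      }
    ; good-even   = λ v∈U e _ → contradiction e (<⇒≢ (reset<k v∈U))
    }
    where
    reset<k : ∀ {v} → v ∈ U → Plan.reset P v < suc k
    reset<k v∈U = s≤s (Plan.reset≤ P v∈U)

  -- Attractors.

  module Attractor {U B A : VSet} (att : IsAttractor (G ∩ U) steven B A) where
    open Forces (proj₁ att)
    open IsStrategy isStr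

    A⊆U : ∀ {v} → v ∈ A → v ∈ U
    A⊆U = inside _

    B⊆A : ∀ {v} → v ∈ B → v ∈ A
    B⊆A = target _

    -- Makes the attractor strategy single-valued at Steven's vertices of `U`; elsewhere `v` itself
    -- is a junk value.
    choice : Vertex → Vertex
    choice v with T? (U v) ×-dec steven? (owner v)
    ... | yes (v∈U , o) = proj₁ (own v v∈U o)
    ... | no _          = v

    choice-σ : ∀ {v} → v ∈ U → owner v ≡ steven → T (σ v (choice v))
    choice-σ {v} v∈U o with T? (U v) ×-dec steven? (owner v)
    ... | yes (v∈U′ , o′) = proj₂ (own v v∈U′ o′)
    ... | no h            = contradiction (v∈U , o) h

    choice-edge : ∀ {v} → v ∈ U → owner v ≡ steven → T (edge v (choice v))
    choice-edge v∈U o = proj₂ (proj₂ (edges _ _ (choice-σ v∈U o)))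

    choice-inside : ∀ {v} → v ∈ U → owner v ≡ steven → choice v ∈ U
    choice-inside v∈U o = proj₁ (proj₂ (edges _ _ (choice-σ v∈U o)))

    Move-σ : ∀ {v u} → v ∈ U → u ∈ U → Move choice v u → T (σ v u)
    Move-σ {v} {u} v∈U u∈U (e , s) = by-owner v
      (λ o → subst (λ u → T (σ v u)) (sym (s o)) (choice-σ v∈U o))
      (λ ¬o → opponent _ _ ¬o (v∈U , u∈U , e))

    -- Adding u to A keeps the target forced, so u ∈ A by maximality.
    closed : ∀ {v u} → v ∈ A → ¬ (v ∈ B) → u ∈ U → Move choice v u → u ∈ A
    closed {v} {u} v∈A v∉B u∈U mv = proj₂ att A′ forces u u∈A′
      where
      A′ : VSet
      A′ w = A w ∨ ⌊ w Fin.≟ u ⌋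
      cases : ∀ {w} → w ∈ A′ → w ∈ A ⊎ w ≡ u
      cases {w} h with Equivalence.to (T-∨ {A w}) h
      ... | inj₁ w∈A = inj₁ w∈A
      ... | inj₂ eq  = inj₂ (toWitness eq)
      u∈A′ : u ∈ A′
      u∈A′ = Equivalence.from (T-∨ {A u}) (inj₂ (fromWitness refl))
      ins : A′ ⊆ Arena.V (G ∩ U)
      ins w w∈A′ with cases w∈A′
      ... | inj₁ w∈A = A⊆U w∈A
      ... | inj₂ refl = u∈U
      vis : ∀ (p : ℕ → Vertex) → p 0 ∈ A′ → (∀ i → T (σ (p i) (p (suc i)))) → ∃[ i ] p i ∈ B
      vis p p0 steps with cases p0
      ... | inj₁ p0∈A = visits p p0∈A steps
      ... | inj₂ p0≡u = tail (visits p⁺ v∈A steps⁺)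
        where
        p⁺ : ℕ → Vertex
        p⁺ zero    = v
        p⁺ (suc i) = p i
        steps⁺ : ∀ i → T (σ (p⁺ i) (p⁺ (suc i)))
        steps⁺ zero    = subst (λ w → T (σ v w)) (sym p0≡u) (Move-σ (A⊆U v∈A) u∈U mv)
        steps⁺ (suc i) = steps i
        tail : (∃[ i ] p⁺ i ∈ B) → ∃[ i ] p i ∈ B
        tail (zero , h)  = contradiction h v∉B
        tail (suc i , h) = i , h
      forces : Forces (G ∩ U) steven B A′
      forces = record
        { inside = ins
        ; target = λ w w∈B → Equivalence.from (T-∨ {A w}) (inj₁ (B⊆A w∈B))
        ; σ      = σ
        ; isStr  = isStr
        ; visits = vis
        }

    -- A path that avoids `B` but meets `A` would stay in `A` by `closed`, hence follow `σ` forever,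
    -- and `visits` would bring it to `B`.
    avoids : (p : ℕ → Vertex) → (∀ t → p t ∈ U) → (∀ t → ¬ (p t ∈ B)) →
             (∀ t → p t ∈ A → Move choice (p t) (p (suc t))) → ∀ t → ¬ (p t ∈ A)
    avoids p p∈U p∉B moves t pt∈A with visits (λ i → p (i + t)) pt∈A steps
      where
      p∈A : ∀ i → p (i + t) ∈ A
      p∈A zero    = pt∈A
      p∈A (suc i) = closed (p∈A i) (p∉B _) (p∈U _) (moves _ (p∈A i))
      steps : ∀ i → T (σ (p (i + t)) (p (suc i + t)))
      steps i = Move-σ (p∈U _) (p∈U _) (moves _ (p∈A i))
    ... | i , h = p∉B _ h

  -- Gluing a strategy on an attractor to a plan for the rest.

  module Glue {U B A : VSet} (att : IsAttractor (G ∩ U) steven B A) {k : ℕ}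
              (next₁ : Vertex → Vertex) (reset₁ : Vertex → ℕ)
              (next₁-edge : ∀ {v} → v ∈ B → owner v ≡ steven → T (edge v (next₁ v)))
              (next₁-inside : ∀ {v} → v ∈ B → owner v ≡ steven → next₁ v ∈ U)
              (reset₁≤ : ∀ {v} → v ∈ B → reset₁ v ≤ k)
              (P₂ : Plan (U ∖ A) k) where
    open Attractor att
    private module P₂ = Plan P₂

    ∈R : ∀ {v} → v ∈ U → ¬ (v ∈ A) → v ∈ (U ∖ A)
    ∈R = ∈-∖ U A

    R⊆U : ∀ {v} → v ∈ (U ∖ A) → v ∈ U
    R⊆U = ∖⇒∈ U A

    R∉A : ∀ {v} → v ∈ (U ∖ A) → ¬ (v ∈ A)
    R∉A = ∖⇒∉ U A

    next : Vertex → Vertex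
    next v = if B v then next₁ v else if A v then choice v else P₂.next v

    reset : Vertex → ℕ
    reset v = if B v then reset₁ v else if A v then 0 else P₂.reset v

    data Zone (v : Vertex) : Set where
      core : v ∈ B → Zone v
      road : v ∈ A → ¬ (v ∈ B) → Zone v
      rest : v ∈ (U ∖ A) → Zone v

    zone : ∀ {v} → v ∈ U → Zone v
    zone {v} v∈U with T? (B v) | T? (A v)
    ... | yes v∈B | _       = core v∈B
    ... | no v∉B  | yes v∈A = road v∈A v∉B
    ... | no _    | no v∉A  = rest (∈R v∈U v∉A)

    R∉B : ∀ {v} → v ∈ (U ∖ A) → ¬ (v ∈ B)
    R∉B v∈R v∈B = R∉A v∈R (B⊆A v∈B)

    next-core : ∀ {v} → v ∈ B → next v ≡ next₁ v
    next-core {v} = if-true (B v)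

    next-road : ∀ {v} → v ∈ A → ¬ (v ∈ B) → next v ≡ choice v
    next-road {v} v∈A v∉B = trans (if-false (B v) v∉B) (if-true (A v) v∈A)

    next-rest : ∀ {v} → v ∈ (U ∖ A) → next v ≡ P₂.next v
    next-rest {v} v∈R = trans (if-false (B v) (R∉B v∈R)) (if-false (A v) (R∉A v∈R))

    reset-core : ∀ {v} → v ∈ B → reset v ≡ reset₁ v
    reset-core {v} = if-true (B v)

    reset-road : ∀ {v} → v ∈ A → ¬ (v ∈ B) → reset v ≡ 0
    reset-road {v} v∈A v∉B = trans (if-false (B v) v∉B) (if-true (A v) v∈A)

    reset-rest : ∀ {v} → v ∈ (U ∖ A) → reset v ≡ P₂.reset v
    reset-rest {v} v∈R = trans (if-false (B v) (R∉B v∈R)) (if-false (A v) (R∉A v∈R))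

    road-closed : ∀ {v u} → v ∈ A → ¬ (v ∈ B) → u ∈ U → Move next v u → u ∈ A
    road-closed v∈A v∉B u∈U mv = closed v∈A v∉B u∈U (Move-cong (next-road v∈A v∉B) mv)

    next-edge : ∀ {v} → v ∈ U → owner v ≡ steven → T (edge v (next v))
    next-edge {v} v∈U o with zone v∈U
    ... | core v∈B     rewrite next-core v∈B     = next₁-edge v∈B o
    ... | road v∈A v∉B rewrite next-road v∈A v∉B = choice-edge v∈U o
    ... | rest v∈R     rewrite next-rest v∈R     = P₂.next-edge v∈R o

    next-inside : ∀ {v} → v ∈ U → owner v ≡ steven → next v ∈ U
    next-inside {v} v∈U o with zone v∈U
    ... | core v∈B     rewrite next-core v∈B     = next₁-inside v∈B o
    ... | road v∈A v∉B rewrite next-road v∈A v∉B = choice-inside v∈U o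
    ... | rest v∈R     rewrite next-rest v∈R     = R⊆U (P₂.next-inside v∈R o)

    reset≤ : ∀ {v} → v ∈ U → reset v ≤ k
    reset≤ {v} v∈U with zone v∈U
    ... | core v∈B     rewrite reset-core v∈B     = reset₁≤ v∈B
    ... | road v∈A v∉B rewrite reset-road v∈A v∉B = z≤n
    ... | rest v∈R     rewrite reset-rest v∈R     = P₂.reset≤ v∈R

    -- A play that never meets `B` never meets `A` either, so it lies in the rest, where `P₂`
    -- settles it. Only the plays through `B` remain.
    glue : (∀ τ → Obeys U next reset τ → ∃[ t ] Trace.vertex τ t ∈ B → Trace.EvenMax τ) → Plan U k
    glue even-core = record
      { next = next ; reset = reset ; next-edge = next-edge ; next-inside = next-inside
      ; reset≤ = reset≤ ; even = even }
      where
      even : ∀ τ → Obeys U next reset τ → Trace.EvenMax τ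
      even τ ob with Trace.visits? τ B
      ... | inj₁ visit = even-core τ ob visit
      ... | inj₂ ∉B = P₂.even τ
        (Obeys-restrict (λ t → ∈R (inside t) (∉A t)) (λ _ → next-rest) (λ _ → reset-rest) ob)
        where
        open Trace τ
        open Obeys ob
        ∉A : ∀ t → ¬ (vertex t ∈ A)
        ∉A = avoids vertex inside ∉B λ t v∈A → Move-cong (next-road v∈A (∉B t)) (moves t)

    module _ {m m₂ w : ℕ} (m₂≤m : m₂ ≤ m) (w-even : parity w ≡ 0ℙ)
             (π≤w : ∀ {v} → v ∈ U → π v ≤ w) (0<k : 0 < k)
             (guard₂ : Guard (U ∖ A) k P₂.next P₂.reset m₂ w) where
      private module G₂ = Guard guard₂

      -- Inside `A` a weak content is invariant enough, since register `k` can be reset only in `B`,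
      -- where `core-even` asks for no more. Moves into `A` are served by `good⇒weak`. A move from
      -- `A` to the rest starts in `B` by `road-closed`, and then `core-step` says that register `k`
      -- has just been overwritten with a priority strong enough for `guard₂`.
      attractor-guard :
        (∀ {v u} → v ∈ B → u ∈ (U ∖ A) → Move next v u → reset₁ v ≡ k × Strong m₂ (π v)) →
        (∀ {v x} → v ∈ B → reset₁ v ≡ k → Weak w x → parity (x ⊔ π v) ≡ 0ℙ) →
        Guard U k next reset m w
      attractor-guard core-step core-even = record
        { Good        = Good
        ; good?       = λ v x → (T? (A v) ×-dec weak? w x) ⊎-dec (¬? (T? (A v)) ×-dec G₂.good? v x)
        ; strong⇒good = strong⇒good
        ; good⇒weak   = good⇒weak
        ; good-step   = good-step
        ; good-even   = good-even
        }
        where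
        Good : Vertex → ℕ → Set
        Good v x = (v ∈ A × Weak w x) ⊎ (¬ (v ∈ A) × G₂.Good v x)
        strong⇒good : ∀ {v x} → v ∈ U → Strong m x → Good v x
        strong⇒good {v} v∈U (ev , m≤x) with T? (A v)
        ... | yes v∈A = inj₁ (v∈A , inj₂ ev)
        ... | no v∉A  = inj₂ (v∉A , G₂.strong⇒good (∈R v∈U v∉A) (ev , ≤-trans m₂≤m m≤x))
        good⇒weak : ∀ {v x} → v ∈ U → Good v x → Weak w x
        good⇒weak v∈U (inj₁ (_ , h))   = h
        good⇒weak v∈U (inj₂ (v∉A , g)) = G₂.good⇒weak (∈R v∈U v∉A) g
        good-step : ∀ {v u x y} → v ∈ U → u ∈ U → Move next v u → Good v x →
                    Updated k (reset v) (π v) x y → Good u y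
        good-step {v} {u} v∈U u∈U mv g up with T? (A u)
        ... | yes u∈A = inj₁ (u∈A , Weak-Updated (π≤w v∈U) w-even (good⇒weak v∈U g) up)
        ... | no u∉A = inj₂ (u∉A , outside (zone v∈U) g up)
          where
          u∈R : u ∈ (U ∖ A)
          u∈R = ∈R u∈U u∉A
          outside : ∀ {x y} → Zone v → Good v x → Updated k (reset v) (π v) x y → G₂.Good u y
          outside (road v∈A v∉B) _ _ = contradiction (road-closed v∈A v∉B u∈U mv) u∉A
          outside (rest v∈R) (inj₁ (v∈A , _)) _ = contradiction v∈A (R∉A v∈R)
          outside (rest v∈R) (inj₂ (_ , g)) up =
            G₂.good-step v∈R u∈R (Move-cong (next-rest v∈R) mv) g
              (subst (λ j → Updated k j _ _ _) (reset-rest v∈R) up)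
          outside (core v∈B) _ (assigned _) =
            G₂.strong⇒good u∈R (proj₂ (core-step v∈B u∈R mv))
          outside (core v∈B) _ (kept lt) =
            contradiction (trans (reset-core v∈B) (proj₁ (core-step v∈B u∈R mv))) (<⇒≢ lt)
        good-even : ∀ {v x} → v ∈ U → reset v ≡ k → Good v x → parity (x ⊔ π v) ≡ 0ℙ
        good-even v∈U e g with zone v∈U
        ... | core v∈B = core-even v∈B (trans (sym (reset-core v∈B)) e) (good⇒weak v∈U g)
        ... | road v∈A v∉B = contradiction (trans (sym (reset-road v∈A v∉B)) e) (<⇒≢ 0<k)
        good-even v∈U e (inj₁ (v∈A , _)) | rest v∈R = contradiction v∈A (R∉A v∈R)
        good-even v∈U e (inj₂ (_ , g))   | rest v∈R =
          G₂.good-even v∈R (trans (sym (reset-rest v∈R)) e) g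

  -- A single layer.

  module Layer {U S A : VSet} (trap : IsTrap (G ∩ U) steven S) (att : IsAttractor (G ∩ U) steven S A)
               {k : ℕ} (P₁ : Plan S k) (P₂ : Plan (U ∖ A) k) where
    private
      module P₁ = Plan P₁
      module P₂ = Plan P₂
    open Attractor att using (A⊆U; B⊆A)

    S⊆U : ∀ {v} → v ∈ S → v ∈ U
    S⊆U = A⊆U ∘ B⊆A

    open Glue att P₁.next P₁.reset P₁.next-edge (λ v∈S o → S⊆U (P₁.next-inside v∈S o)) P₁.reset≤ P₂
      using (next; reset; next-core; reset-core; reset-road; reset-rest; glue; zone; core; road; rest;
             attractor-guard; R⊆U; R∉A)

    -- Steven stays in `S` by his plan, and Audrey because the strategy that traps her in `S`
    -- contains all her edges within `U`.
    S-closed : ∀ {v u} → v ∈ S → u ∈ U → Move next v u → u ∈ S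
    S-closed {v} {u} v∈S u∈U (e , s) = by-owner v
      (λ o → subst (_∈ S) (sym (trans (s o) (next-core v∈S))) (P₁.next-inside v∈S o))
      (λ ¬o → TrapsIn.closed traps v u v∈S
        (IsStrategy.opponent strategy v u ¬o (S⊆U v∈S , u∈U , e)))
      where
      strategy = proj₁ (proj₂ trap)
      traps    = proj₂ (proj₂ trap)

    -- A periodic play that visits `S` never leaves it, so it is in `S` at all times and `P₁`
    -- settles it.
    layer-plan : Plan U k
    layer-plan = glue λ τ ob (_ , v∈S) → P₁.even τ (Obeys-restrict
        (Trace.stays τ S (λ t h → S-closed h (Obeys.inside ob (suc t)) (Obeys.moves ob t)) v∈S)
        (λ _ → next-core) (λ _ → reset-core) ob)

    -- For a layer that does not reset register `k`. No move leads from `S` to the rest, so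
    -- `core-step` holds vacuously, and the invariant is weakness in `A` and that of the later
    -- layers beyond.
    small-guard : ∀ {m w} → parity w ≡ 0ℙ → (∀ {v} → v ∈ U → π v ≤ w) → 0 < k →
                  (∀ {v} → v ∈ S → P₁.reset v < k) →
                  Guard (U ∖ A) k P₂.next P₂.reset m w → Guard U k next reset m w
    small-guard w-even π≤w 0<k reset<k guard₂ = attractor-guard ≤-refl w-even π≤w 0<k guard₂
      (λ v∈S u∈R mv → contradiction (B⊆A (S-closed v∈S (R⊆U u∈R) mv)) (R∉A u∈R))
      (λ v∈S e _ → contradiction e (<⇒≢ (reset<k v∈S)))

    -- For the layer that may reset register `k`. Nothing else in `U` resets it, so strength lasts
    -- until `S` is entered; `S` is never left, so its own invariant then takes over for good.
    big-guard : ∀ {m w₁ w} → w₁ ≤ w → (∀ {v} → v ∈ U → π v ≤ m) → 0 < k →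
                (∀ {v} → v ∈ (U ∖ A) → P₂.reset v < k) →
                Guard S k P₁.next P₁.reset m w₁ → Guard U k next reset m w
    big-guard {m} {w₁} {w} w₁≤w π≤m 0<k reset<k guard₁ = record
      { Good        = Good
      ; good?       = λ v x → (T? (S v) ×-dec G₁.good? v x) ⊎-dec (¬? (T? (S v)) ×-dec strong? m x)
      ; strong⇒good = λ _ → strong⇒good
      ; good⇒weak   = λ _ → good⇒weak
      ; good-step   = good-step
      ; good-even   = good-even
      }
      where
      module G₁ = Guard guard₁
      Good : Vertex → ℕ → Set
      Good v x = (v ∈ S × G₁.Good v x) ⊎ (¬ (v ∈ S) × Strong m x)
      strong⇒good : ∀ {v x} → Strong m x → Good v x
      strong⇒good {v} s with T? (S v)
      ... | yes v∈S = inj₁ (v∈S , G₁.strong⇒good v∈S s)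
      ... | no v∉S  = inj₂ (v∉S , s)
      good⇒weak : ∀ {v x} → Good v x → Weak w x
      good⇒weak (inj₂ (_ , ev , _)) = inj₂ ev
      good⇒weak (inj₁ (v∈S , g)) with G₁.good⇒weak v∈S g
      ... | inj₁ x≤w₁ = inj₁ (≤-trans x≤w₁ w₁≤w)
      ... | inj₂ ev   = inj₂ ev
      outside-reset : ∀ {v} → v ∈ U → ¬ (v ∈ S) → reset v < k
      outside-reset v∈U v∉S with zone v∈U
      ... | core v∈S     = contradiction v∈S v∉S
      ... | road v∈A v∉B = subst (_< k) (sym (reset-road v∈A v∉B)) 0<k
      ... | rest v∈R     = subst (_< k) (sym (reset-rest v∈R)) (reset<k v∈R)
      good-step : ∀ {v u x y} → v ∈ U → u ∈ U → Move next v u → Good v x →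
                  Updated k (reset v) (π v) x y → Good u y
      good-step v∈U u∈U mv (inj₁ (v∈S , g)) up = inj₁ (u∈S ,
        G₁.good-step v∈S u∈S (Move-cong (next-core v∈S) mv) g
          (subst (λ j → Updated k j _ _ _) (reset-core v∈S) up))
        where u∈S = S-closed v∈S u∈U mv
      good-step v∈U u∈U mv (inj₂ (v∉S , s)) (kept _) = strong⇒good (Strong-⊔ _ (π≤m v∈U) s)
      good-step v∈U u∈U mv (inj₂ (v∉S , s)) (assigned e) =
        contradiction e (<⇒≢ (outside-reset v∈U v∉S))
      good-even : ∀ {v x} → v ∈ U → reset v ≡ k → Good v x → parity (x ⊔ π v) ≡ 0ℙ
      good-even v∈U e (inj₁ (v∈S , g)) = G₁.good-even v∈S (trans (sym (reset-core v∈S)) e) g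
      good-even v∈U e (inj₂ (v∉S , _)) = contradiction e (<⇒≢ (outside-reset v∈U v∉S))

  -- The attractor to the highest priority.

  -- The guard of the rest must accept both the content `d`, written by a visit to priority `d`, and
  -- any even initial content of at least `m`; `d ⊓ m` is a bound that both meet.
  module Top {d : ℕ} {U A : VSet} (d-even : parity d ≡ 0ℙ) (π≤d : ∀ {v} → v ∈ U → π v ≤ d)
             (att : IsAttractor (G ∩ U) steven (withPriority G steven d U) A) {m k′ : ℕ}
             (rest-plan : GuardedPlan (U ∖ A) (suc k′) (d ⊓ m) d) where
    private
      k = suc k′
      B = withPriority G steven d U
      P₂ = GuardedPlan.plan rest-plan
      guard₂ = GuardedPlan.guard rest-plan

    open Attractor att using (choice; choice-edge; choice-inside; A⊆U; B⊆A)

    π≡d : ∀ {v} → v ∈ B → π v ≡ d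
    π≡d {v} v∈B = ≡ᵇ⇒≡ (π v) d (proj₂ (Equivalence.to (T-∧ {U v}) v∈B))

    open Glue att choice (λ _ → k) (λ v∈B → choice-edge (A⊆U (B⊆A v∈B)))
      (λ v∈B → choice-inside (A⊆U (B⊆A v∈B))) (λ _ → ≤-refl) P₂

    strong-d : ∀ {v} → v ∈ B → Strong (d ⊓ m) (π v)
    strong-d v∈B rewrite π≡d v∈B = d-even , m⊓n≤m d m

    core-even : ∀ {v x} → v ∈ B → Weak d x → parity (x ⊔ π v) ≡ 0ℙ
    core-even {x = x} v∈B h rewrite π≡d v∈B with h
    ... | inj₁ x≤d rewrite m≤n⇒m⊔n≡n x≤d = d-even
    ... | inj₂ ev = ⊔-even x d ev d-even

    -- `m′` is left open because the guard is used twice: with `m` towards the outside, and with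
    -- `d ⊓ m` in `even-core`, where the content is only known to be `d`, which may lie below `m`.
    top-guard : ∀ {m′} → d ⊓ m ≤ m′ → Guard U k next reset m′ d
    top-guard m₂≤m′ = attractor-guard m₂≤m′ d-even π≤d (s≤s z≤n) guard₂
      (λ v∈B _ _ → refl , strong-d v∈B) (λ v∈B _ → core-even v∈B)

    open Guard (top-guard ≤-refl)

    -- A visit to priority d puts d into register k, which makes the invariant
    -- hold from then on, hence throughout a periodic play.
    even-core : ∀ τ → Obeys U next reset τ → ∃[ t ] Trace.vertex τ t ∈ B → Trace.EvenMax τ
    even-core τ ob (s , v∈B) = k , rank≤ , s , rank-even s (trans (resets s) (reset-core v∈B))
      where
      open Trace τ renaming (reset to resetAt)
      open Obeys ob
      updated : ∀ t → Updated k (reset (vertex t)) (π (vertex t)) (register t k) (register (suc t) k)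
      updated t with m≤n⇒m<n∨m≡n (reset≤ (inside t))
      ... | inj₁ lt = subst (Updated k _ _ _) (sym (keeps t k (subst (_< k) (sym (resets t)) lt))) (kept lt)
      ... | inj₂ eq = subst (Updated k _ _ _) (sym (assigns t k′ (trans (resets t) eq))) (assigned eq)
      good-after : Good (vertex (suc s)) (register (suc s) k)
      good-after = strong⇒good (inside (suc s)) (subst (Strong (d ⊓ m))
        (sym (assigns s k′ (trans (resets s) (reset-core v∈B)))) (strong-d v∈B))
      good : ∀ t → Good (vertex t) (register t k)
      good = Periodic.persists (λ t → Good (vertex t) (register t k)) period
        (λ t → subst₂ Good (vertex-periodic t) (register-periodic t k))
        (λ t g → good-step (inside t) (inside (suc t)) (moves t) g (updated t)) good-after
      rank-even : ∀ t → resetAt t ≡ k → rankAt t ≡ 2 * k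
      rank-even t eq rewrite eq =
        rankOf-even k′ (register t k ⊔ π (vertex t)) (good-even (inside t) (trans (sym (resets t)) eq) (good t))
      rank≤ : ∀ t → rankAt t ≤ 2 * k
      rank≤ t with m≤n⇒m<n∨m≡n (subst (_≤ k) (sym (resets t)) (reset≤ (inside t)))
      ... | inj₁ lt = rankOf-< _ lt
      ... | inj₂ eq = ≤-reflexive (rank-even t eq)

    top : GuardedPlan U k m d
    top = glue even-core , top-guard (m⊓n≤n d m)

  -- Recursion over the decomposition.

  -- The separate bound `m` lets the demand on register `suc k` stay that of the enclosing game
  -- while `d` drops on the way down.
  fromDecomposition : ∀ {d U k m} → (∀ {v} → v ∈ U → π v ≤ m) → (H : Decomposition G steven d U) →
                      strahler (tree H) ≤ suc k → GuardedPlan U (suc k) m d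
  fromLayers : ∀ {w U k m} → parity w ≡ 0ℙ → (∀ {v} → v ∈ U → π v ≤ w) → (∀ {v} → v ∈ U → π v ≤ m) →
               (ls : Layers G steven w U) → Fit (suc k) (strahlers (trees ls)) →
               GuardedPlan U (suc k) m w
  -- A periodic play is confined to one `S`, so the layers can share the same `k` registers without
  -- any guard passing between them.
  fromSmallLayers : ∀ {w U k} → (ls : Layers G steven w U) → All (_< suc k) (strahlers (trees ls)) → Plan U k

  fromDecomposition {U = U} π≤m (decomposition d-even π≤d A att ls) h =
    Top.top d-even (π≤d _) att
      (fromLayers d-even (λ v∈R → π≤d _ (∖⇒∈ U A v∈R))
        (λ v∈R → ⊓-glb (π≤d _ (∖⇒∈ U A v∈R)) (π≤m (∖⇒∈ U A v∈R))) ls (strahler-Fit _ h))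

  -- No remaining layer needs register `suc k`: they are solved with `k` registers and a strong
  -- content of the top one is merely preserved.
  fromLayers {w} {U} _ _ π≤m (done empty) (small hs) =
    guardUnreset π≤m (fromSmallLayers (done {d = w} {U} empty) hs)
  fromLayers _ _ π≤m (layer S trap π≤d H A att ls) (small hs) =
    guardUnreset π≤m (fromSmallLayers (layer S trap π≤d H A att ls) hs)
  -- Strahler numbers are positive, so no subtree has one below `1`.
  fromLayers {k = zero} _ _ _ (layer S trap π≤d H A att ls) (small∷ h f) =
    contradiction (≤-trans h (strahler≥1 (tree H))) (<-irrefl refl)
  fromLayers {U = U} {suc k} w-even π≤w π≤m (layer S trap π≤d H A att ls) (small∷ h f) =
    layer-plan , small-guard w-even π≤w (s≤s z≤n) (λ v∈S → s≤s (Plan.reset≤ P₁ v∈S)) guard₂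
    where
    -- Only the plan is kept: its guard concerns register `suc k`, one below the register guarded
    -- here.
    P₁ = GuardedPlan.plan (fromDecomposition (π≤d _) H (s≤s⁻¹ h))
    open GuardedPlan (fromLayers w-even (π≤w ∘ ∖⇒∈ U A) (π≤m ∘ ∖⇒∈ U A) ls f) renaming (plan to P₂; guard to guard₂)
    open Layer trap att (weaken (n≤1+n _) P₁) P₂
  fromLayers w-even π≤w π≤m (layer S trap π≤d H A att ls) (big∷ h hs) =
    layer-plan , big-guard (m≤n+m _ 2) π≤m (s≤s z≤n) (λ v∈R → s≤s (Plan.reset≤ P₂ v∈R)) guard₁
    where
    P₂ = fromSmallLayers ls hs
    open Attractor att using (A⊆U; B⊆A)
    -- Called with the `m` of the whole sequence, because the content that arrives in `S` is strong
    -- for that `m`.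
    open GuardedPlan (fromDecomposition (λ v∈S → π≤m (A⊆U (B⊆A v∈S))) H h) renaming (plan to P₁; guard to guard₁)
    open Layer trap att P₁ (weaken (n≤1+n _) P₂)

  fromSmallLayers (done empty) _ = record
    { next        = λ v → v
    ; reset       = λ _ → 0
    ; next-edge   = λ v∈U → contradiction v∈U (empty _)
    ; next-inside = λ v∈U → contradiction v∈U (empty _)
    ; reset≤      = λ v∈U → contradiction v∈U (empty _)
    ; even        = λ τ ob → contradiction (Obeys.inside ob 0) (empty _)
    }
  fromSmallLayers {k = zero} (layer S trap π≤d H A att ls) (h ∷ hs) =
    contradiction (≤-trans h (strahler≥1 (tree H))) (<-irrefl refl)
  fromSmallLayers {U = U} {suc k} (layer S trap π≤d H A att ls) (h ∷ hs) =
    Layer.layer-plan trap att (GuardedPlan.plan (fromDecomposition (π≤d _) H (s≤s⁻¹ h))) (fromSmallLayers ls hs)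

-- The register game

-- The default closes cycles: with `v` as default, the entry just past the end of `v ∷ vs` is `v`
-- again.
nth : ∀ {A : Set} → A → List A → ℕ → A
nth z []       _       = z
nth z (x ∷ xs) zero    = x
nth z (x ∷ xs) (suc i) = nth z xs i

All-nth : ∀ {A : Set} {P : A → Set} {z xs} i → All P xs → i < length xs → P (nth z xs i)
All-nth zero    (px ∷ _)  _   = px
All-nth (suc i) (_ ∷ pxs) i<n = All-nth i pxs (s≤s⁻¹ i<n)

nth-All : ∀ {A : Set} {P : A → Set} {z} xs → (∀ i → i < length xs → P (nth z xs i)) → All P xs
nth-All []       h = []
nth-All (x ∷ xs) h = h 0 (s≤s z≤n) ∷ nth-All xs (λ i i<n → h (suc i) (s≤s i<n))

nth-Any : ∀ {A : Set} {P : A → Set} {z} xs i → i < length xs → P (nth z xs i) → Any P xs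
nth-Any (x ∷ xs) zero    _   p = here p
nth-Any (x ∷ xs) (suc i) i<n p = there (nth-Any xs i (s≤s⁻¹ i<n) p)

Linked-nth : ∀ {A : Set} {R : A → A → Set} {z} xs i → Linked R (xs ++ [ z ]) → i < length xs →
             R (nth z xs i) (nth z xs (suc i))
Linked-nth (x ∷ [])     zero    (r ∷ _)  _   = r
Linked-nth (x ∷ y ∷ xs) zero    (r ∷ _)  _   = r
Linked-nth (x ∷ [])     (suc i) _        i<n = contradiction (s≤s⁻¹ i<n) λ ()
Linked-nth (x ∷ y ∷ xs) (suc i) (_ ∷ rs) i<n = Linked-nth (y ∷ xs) i rs (s≤s⁻¹ i<n)

suc-% : ∀ t n → (suc t % suc n ≡ suc (t % suc n)) ⊎ (t % suc n ≡ n × suc t % suc n ≡ 0)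
suc-% t n = by-cases (m≤n⇒m<n∨m≡n (m%n<n t N))
  where
  N = suc n
  reduce : suc t % N ≡ suc (t % N) % N
  reduce = trans (cong (λ m → suc m % N) (m≡m%n+[m/n]*n t N)) ([m+kn]%n≡m%n (suc (t % N)) (t / N) N)
  by-cases : suc (t % N) < N ⊎ suc (t % N) ≡ N → _
  by-cases (inj₁ lt) = inj₁ (trans reduce (m<n⇒m%n≡m lt))
  by-cases (inj₂ eq) = inj₂ (suc-injective eq , trans reduce (trans (cong (_% N) eq) (n%n≡0 N)))

even-odd : (P : ℕ → Set) → (∀ t → P (t * 2)) → (∀ t → P (suc (t * 2))) → ∀ i → P i
even-odd P f g zero          = f 0
even-odd P f g (suc zero)    = g 0
even-odd P f g (suc (suc i)) = even-odd (λ i → P (2 + i)) (λ t → f (suc t)) (λ t → g (suc t)) i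

1≤rankOf : ∀ j x → 1 ≤ rankOf j x
1≤rankOf zero    x = ≤-refl
1≤rankOf (suc j) x with parity x
... | 0ℙ = s≤s z≤n
... | 1ℙ = s≤s z≤n

rankOf≤ : ∀ j x → rankOf j x ≤ 2 * j + 1
rankOf≤ zero    x = ≤-refl
rankOf≤ (suc j) x with parity x
... | 0ℙ = m≤m+n _ 1
... | 1ℙ = ≤-refl

module RegisterUpdate (𝒢 : ParityGame) (k : ℕ) where
  open ParityGame 𝒢 using (d)
  open RegisterGame 𝒢 k

  -- The function tabulated by `update` is local to its definition; unification recovers it here,
  -- and `entry` gives it a name.
  update-tabulates : ∀ i q r → ∃[ f ] update i q r ≡ tabulate f
  update-tabulates i q r = _ , refl

  entry : Fin (suc k) → ℕ → Registers → Fin k → ℕ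
  entry i q r = proj₁ (update-tabulates i q r)

  lookup-update : ∀ i q r j → lookup (update i q r) j ≡ entry i q r j
  lookup-update i q r = Vec.lookup∘tabulate (entry i q r)

  lookup-update-< : ∀ {i q r} j → suc (toℕ j) < toℕ i → lookup (update i q r) j ≡ 0
  lookup-update-< {i} {q} {r} j lt = trans (lookup-update i q r j) reduce
    where
    reduce : entry i q r j ≡ 0
    reduce with <-cmp (suc (toℕ j)) (toℕ i)
    ... | tri< _ _ _ = refl
    ... | tri≈ ≮ _ _ = contradiction lt ≮
    ... | tri> ≮ _ _ = contradiction lt ≮

  lookup-update-≡ : ∀ {i q r} j → suc (toℕ j) ≡ toℕ i → lookup (update i q r) j ≡ q
  lookup-update-≡ {i} {q} {r} j eq = trans (lookup-update i q r j) reduce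
    where
    reduce : entry i q r j ≡ q
    reduce with <-cmp (suc (toℕ j)) (toℕ i)
    ... | tri< _ ≢ _ = contradiction eq ≢
    ... | tri≈ _ _ _ = refl
    ... | tri> _ ≢ _ = contradiction eq ≢

  lookup-update-> : ∀ {i q r} j → toℕ i < suc (toℕ j) → lookup (update i q r) j ≡ lookup r j ⊔ q
  lookup-update-> {i} {q} {r} j gt = trans (lookup-update i q r j) reduce
    where
    reduce : entry i q r j ≡ lookup r j ⊔ q
    reduce with <-cmp (suc (toℕ j)) (toℕ i)
    ... | tri< _ _ ≯ = contradiction gt ≯
    ... | tri≈ _ _ ≯ = contradiction gt ≯
    ... | tri> _ _ _ = refl

  lookup-mono : ∀ {r i j} → Valid r → toℕ i ≤ toℕ j → lookup r i ≤ lookup r j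
  lookup-mono {r} (linked , _) i≤j with m≤n⇒m<n∨m≡n i≤j
  ... | inj₁ lt = VecLinked.lookup⁺ ≤-trans linked lt
  ... | inj₂ eq = ≤-reflexive (cong (lookup r) (Fin.toℕ-injective eq))

  mono-linked : ∀ {l} (r : Vec ℕ l) → (∀ i j → toℕ i ≤ toℕ j → lookup r i ≤ lookup r j) →
                VecLinked.Linked _≤_ r
  mono-linked []          _ = VecLinked.[]
  mono-linked (x ∷ [])    _ = VecLinked.[-]
  mono-linked (x ∷ y ∷ r) h =
    h zero (suc zero) z≤n VecLinked.∷ mono-linked (y ∷ r) (λ i j i≤j → h (suc i) (suc j) (s≤s i≤j))

  -- The new registers are zeros, then `q`, then maxima with `q`, so the order holds across each
  -- boundary.
  update-Valid : ∀ {i q r} → q ≤ d → Valid r → Valid (update i q r)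
  update-Valid {i} {q} {r} q≤d valid = mono-linked _ mono , VecAll.lookup⁻ bounded
    where
    bounded : ∀ j → lookup (update i q r) j ≤ d
    bounded j with <-cmp (suc (toℕ j)) (toℕ i)
    ... | tri< lt _ _ = ≤-trans (≤-reflexive (lookup-update-< j lt)) z≤n
    ... | tri≈ _ eq _ = ≤-trans (≤-reflexive (lookup-update-≡ {i} {q} {r} j eq)) q≤d
    ... | tri> _ _ gt = ≤-trans (≤-reflexive (lookup-update-> {i} {q} {r} j gt))
      (⊔-lub (VecAll.lookup⁺ (proj₂ valid) j) q≤d)
    mono : ∀ j j′ → toℕ j ≤ toℕ j′ → lookup (update i q r) j ≤ lookup (update i q r) j′
    mono j j′ j≤j′ with <-cmp (suc (toℕ j)) (toℕ i)
    ... | tri< lt _ _ = ≤-trans (≤-reflexive (lookup-update-< j lt)) z≤n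
    ... | tri> _ _ gt = begin
      lookup (update i q r) j  ≡⟨ lookup-update-> {i} {q} {r} j gt ⟩
      lookup r j ⊔ q           ≤⟨ ⊔-monoˡ-≤ q (lookup-mono valid j≤j′) ⟩
      lookup r j′ ⊔ q          ≡⟨ sym (lookup-update-> {i} {q} {r} j′ (<-≤-trans gt (s≤s j≤j′))) ⟩
      lookup (update i q r) j′ ∎
      where open ≤-Reasoning
    ... | tri≈ _ eq _ with m≤n⇒m<n∨m≡n j≤j′
    ...   | inj₂ same = ≤-reflexive (cong (lookup (update i q r)) (Fin.toℕ-injective same))
    ...   | inj₁ j<j′ = begin
      lookup (update i q r) j  ≡⟨ lookup-update-≡ {i} {q} {r} j eq ⟩
      q                        ≤⟨ m≤n⊔m (lookup r j′) q ⟩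
      lookup r j′ ⊔ q          ≡⟨ sym (lookup-update-> {i} {q} {r} j′ (subst (_< _) eq (s≤s j<j′))) ⟩
      lookup (update i q r) j′ ∎
      where open ≤-Reasoning

  at : ∀ {l} → Vec ℕ l → ℕ → ℕ
  at []       _       = d
  at (x ∷ xs) zero    = x
  at (x ∷ xs) (suc j) = at xs j

  at-lookup : ∀ {l} (r : Vec ℕ l) i → at r (toℕ i) ≡ lookup r i
  at-lookup (x ∷ r) zero    = refl
  at-lookup (x ∷ r) (suc i) = at-lookup r i

  at-replicate : ∀ l j → at (replicate l d) j ≡ d
  at-replicate zero    j       = refl
  at-replicate (suc l) zero    = refl
  at-replicate (suc l) (suc j) = at-replicate l j

  at-last : ∀ {l} (r : Vec ℕ (suc l)) → at r l ≡ last r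
  at-last (x ∷ [])    = refl
  at-last (x ∷ y ∷ r) = at-last (y ∷ r)

  -- Register 0 and the registers above k do not exist; d is never increased
  -- by a priority, so it serves as their content.
  content : Registers → ℕ → ℕ
  content r zero    = d
  content r (suc j) = at r j

  at-⊔ : ∀ {l} (r r′ : Vec ℕ l) q j → q ≤ d → (∀ i → toℕ i ≡ j → lookup r′ i ≡ lookup r i ⊔ q) →
         at r′ j ≡ at r j ⊔ q
  at-⊔ []      []        q j       q≤d h = sym (m≥n⇒m⊔n≡m q≤d)
  at-⊔ (x ∷ r) (y ∷ r′)  q zero    q≤d h = h zero refl
  at-⊔ (x ∷ r) (y ∷ r′)  q (suc j) q≤d h = at-⊔ r r′ q j q≤d (λ i e → h (suc i) (cong suc e))

  content-keeps : ∀ {i q r} j → q ≤ d → toℕ i < j → content (update i q r) j ≡ content r j ⊔ q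
  content-keeps {i} {q} {r} (suc j) q≤d i<j =
    at-⊔ r (update i q r) q j q≤d (λ l e → lookup-update-> l (subst (λ j → toℕ i < suc j) (sym e) i<j))

  content-assigns : ∀ {i q r} j → toℕ i ≡ suc j → content (update i q r) (suc j) ≡ q
  content-assigns {suc i} {q} {r} .(toℕ i) refl =
    trans (at-lookup (update (suc i) q r) i) (lookup-update-≡ i refl)

  rankOfChoice-rankOf : ∀ i q r → rankOfChoice i q r ≡ rankOf (toℕ i) (content r (toℕ i) ⊔ q)
  rankOfChoice-rankOf zero    q r = refl
  rankOfChoice-rankOf (suc i) q r rewrite at-lookup r i with parity (lookup r i ⊔ q)
  ... | 0ℙ = refl
  ... | 1ℙ = refl

-- From a guarded plan to a defensive dominion strategy.

module RegisterStrategy (𝒢 : ParityGame) (k : ℕ) where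
  open ParityGame 𝒢 renaming (arena to G)
  open Strategies 𝒢
  private
    K : ℕ
    K = suc k
  open RegisterGame 𝒢 K renaming (arena to R)
  open RegisterUpdate 𝒢 K

  module CyclePath {σ : Strategy State} {W : Subset State} {v : State} {vs : List State}
                   (cycle : IsCycle R steven σ W v vs) where
    open IsCycle cycle

    private
      N : ℕ
      N = suc (length vs)

    -- The cycle unrolled into an infinite periodic path, from which a `Trace` can be read off.
    path : ℕ → State
    path t = nth v (v ∷ vs) (t % N)

    path-periodic : ∀ t → path (t + N) ≡ path t
    path-periodic t = cong (nth v (v ∷ vs)) ([m+n]%n≡m%n t N)

    path-inside : ∀ t → path t ∈ W
    path-inside t = All-nth (t % N) inside (m%n<n t N)

    path-moves : ∀ t → T (σ (path t) (path (suc t)))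
    path-moves t with Linked-nth {z = v} (v ∷ vs) (t % N) linked (m%n<n t N) | suc-% t (length vs)
    ... | σ-move | inj₁ eq rewrite eq = σ-move
    -- At the last index `nth` runs off the list and returns its default, the first state.
    ... | σ-move | inj₂ (last , first) rewrite last | first =
      subst (λ u → T (σ (nth v (v ∷ vs) (length vs)) u)) (nth-default vs) σ-move
      where
      nth-default : ∀ ws → nth v ws (length ws) ≡ v
      nth-default []       = refl
      nth-default (_ ∷ ws) = nth-default ws

    highest-even : (∃[ c ] (∀ i → rank (path i) ≤ 2 * c) × ∃[ i ] rank (path i) ≡ 2 * c) →
                   parity (highest R steven (v ∷ vs)) ≡ 0ℙ
    highest-even (c , rank≤ , i , rank≡) = trans (cong parity highest≡) (parity-double c)
      where
      nth-rank≤ : ∀ j → j < N → rank (nth v (v ∷ vs) j) ≤ 2 * c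
      nth-rank≤ j j<N = subst (λ j → rank (nth v (v ∷ vs) j) ≤ 2 * c) (m<n⇒m%n≡m j<N) (rank≤ j)
      highest≡ : highest R steven (v ∷ vs) ≡ 2 * c
      highest≡ = ≤-antisym
        (max≤v⁺ z≤n (All.map⁺ (nth-All (v ∷ vs) nth-rank≤)))
        (v≤max⁺ 0 _ (inj₂ (Any.map⁺ (nth-Any (v ∷ vs) (i % N) (m%n<n i N) (≤-reflexive (sym rank≡))))))

  module Winning {D : Subset (Fin n)} {c w : ℕ} (gp : GuardedPlan D K c w)
                 (opponent-stays : ∀ {v u} → v ∈ D → ¬ (owner v ≡ steven) → T (edge v u) → u ∈ D) where
    open GuardedPlan gp
    open Plan plan using (next; reset; next-edge; next-inside; reset≤; even)
    open Guard guard

    -- A strategy must offer a move at all of Steven's states, also outside `D`, where any successor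
    -- will do.
    next′ : Fin n → Fin n
    next′ v = if D v then next v else proj₁ (total v)

    next′-D : ∀ {v} → v ∈ D → next′ v ≡ next v
    next′-D {v} = if-true (D v)

    next′-edge : ∀ v → owner v ≡ steven → T (edge v (next′ v))
    next′-edge v o with T? (D v)
    ... | yes v∈D = subst (λ u → T (edge v u)) (sym (next′-D v∈D)) (next-edge v∈D o)
    ... | no v∉D  = subst (λ u → T (edge v u)) (sym (if-false (D v) v∉D)) (proj₂ (total v))

    -- The cap at `K` makes the index well defined outside `D`; on `D` it changes nothing by
    -- `reset≤`.
    index : Fin n → Fin (suc K)
    index v = fromℕ< (s≤s (m⊓n≤n (reset v) K))

    index-D : ∀ {v} → v ∈ D → toℕ (index v) ≡ reset v
    index-D {v} v∈D = trans (Fin.toℕ-fromℕ< _) (m≤n⇒m⊓n≡m (reset≤ v∈D))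

    Move-inside : ∀ {v u} → v ∈ D → Move next′ v u → Move next v u × u ∈ D
    Move-inside {v} v∈D mv@(e , s) = mv′ , by-owner v
      (λ o → subst (_∈ D) (sym (Move.chosen mv′ o)) (next-inside v∈D o))
      (λ ¬o → opponent-stays v∈D ¬o e)
      where
      mv′ : Move next v _
      mv′ = Move-cong (next′-D v∈D) mv

    move? : ∀ v u → Dec (Move next′ v u)
    move? v u = map′ (λ { (e , s) → e , s }) (λ { (e , s) → e , s })
      (T? (edge v u) ×-dec (steven? (owner v) →-dec (u Fin.≟ next′ v)))

    pickAt : Fin n → Registers → State
    pickAt v r = move v (update (index v) (π v) r) (rankOfChoice (index v) (π v) r)

    data Plays : State → State → Set where
      pick : ∀ {v r} → Valid r → Plays (choose v r) (pickAt v r)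
      step : ∀ {v u r p} → move v r p ∈ states → Move next′ v u → Plays (move v r p) (choose u r)

    plays? : ∀ s s′ → Dec (Plays s s′)
    plays? (choose v r) (choose _ _) = no λ ()
    plays? (choose v r) (move v′ r′ p) = map′
      (λ { (valid , refl , refl , refl) → pick valid })
      (λ { (pick valid) → valid , refl , refl , refl })
      (valid? r ×-dec (v′ Fin.≟ v ×-dec (Vec.≡-dec _≟_ r′ (update (index v) (π v) r) ×-dec
        (p ≟ rankOfChoice (index v) (π v) r))))
    plays? (move v r p) (choose u r′) = map′
      (λ { (s , mv , refl) → step s mv })
      (λ { (step s mv) → s , mv , refl })
      (T? (states (move v r p)) ×-dec (move? v u ×-dec (Vec.≡-dec _≟_ r′ r)))
    plays? (move _ _ _) (move _ _ _) = no λ ()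

    σ : Strategy State
    σ s s′ = ⌊ plays? s s′ ⌋

    -- Between pick and move, the registers must be good at every vertex the play may go to next;
    -- this carries the invariant through the middle of a round.
    InW : State → Set
    InW (choose v r) = Valid r × v ∈ D × Good v (last r)
    InW (move v r p) = move v r p ∈ states × v ∈ D × p ≢ 2 * K + 1 ×
                       (∀ u → Move next′ v u → Good u (last r))

    inW? : ∀ s → Dec (InW s)
    inW? (choose v r) = valid? r ×-dec (T? (D v) ×-dec good? v (last r))
    inW? (move v r p) = T? (states (move v r p)) ×-dec (T? (D v) ×-dec (¬? (p ≟ 2 * K + 1) ×-dec
                        Fin.all? (λ u → move? v u →-dec good? u (last r))))

    W : Subset State
    W s = ⌊ inW? s ⌋

    rankOfChoice-bounds : ∀ i q r → 1 ≤ rankOfChoice i q r × rankOfChoice i q r ≤ 2 * K + 1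
    rankOfChoice-bounds i q r rewrite rankOfChoice-rankOf i q r =
      1≤rankOf (toℕ i) _ ,
      ≤-trans (rankOf≤ (toℕ i) _) (+-monoˡ-≤ 1 (*-monoʳ-≤ 2 (s≤s⁻¹ (Fin.toℕ<n i))))

    pickAt-state : ∀ {v r} → Valid r → pickAt v r ∈ states
    pickAt-state {v} {r} valid = fromWitness
      (update-Valid {index v} {π v} {r} (π≤d v) valid , rankOfChoice-bounds (index v) (π v) r)

    isStrategy : IsStrategy R steven σ
    isStrategy = record { edges = edges ; own = own ; opponent = opponent }
      where
      edges : ∀ s s′ → T (σ s s′) → Arena.Edge R s s′
      edges s s′ h with toWitness {a? = plays? s s′} h
      ... | pick {v} {r} valid = fromWitness valid , pickAt-state valid , pick v r (index v)
      ... | step {v} {u} {r} {p} st (e , _) =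
        st , fromWitness (proj₁ (toWitness st)) , step v u r p (tt , tt , e)
      own : ∀ s → s ∈ states → stateOwner s ≡ steven → ∃[ s′ ] T (σ s s′)
      own (choose v r) st _ = pickAt v r , fromWitness (pick (toWitness st))
      own (move v r p) st o = choose (next′ v) r ,
        fromWitness (step st (next′-edge v o , λ _ → refl))
      opponent : ∀ s s′ → stateOwner s ≢ steven → Arena.Edge R s s′ → T (σ s s′)
      opponent (choose v r) _ ¬o _ = contradiction refl ¬o
      opponent (move v r p) (choose u r) ¬o (st , _ , step v u r p (_ , _ , e)) =
        fromWitness (step st (e , λ o → contradiction o ¬o))

    updated : ∀ {v r} → v ∈ D → Updated K (reset v) (π v) (last r) (last (update (index v) (π v) r))
    updated {v} {r} v∈D with m≤n⇒m<n∨m≡n (reset≤ v∈D)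
    ... | inj₁ lt = subst (Updated K _ _ _)
      (trans (cong (_⊔ π v) (sym (at-last r)))
        (trans (sym (content-keeps {index v} {π v} {r} K (π≤d v) (subst (_< K) (sym (index-D v∈D)) lt)))
          (at-last (update (index v) (π v) r)))) (kept lt)
    ... | inj₂ eq = subst (Updated K _ _ _)
      (trans (sym (content-assigns {index v} {π v} {r} k (trans (index-D v∈D) eq)))
        (at-last (update (index v) (π v) r))) (assigned eq)

    -- Rank `2 * K + 1` arises only from an odd reset of register `K`, which `good-even` excludes.
    pickAt-rank : ∀ {v r} → v ∈ D → Good v (last r) → rankOfChoice (index v) (π v) r ≢ 2 * K + 1
    pickAt-rank {v} {r} v∈D g e = <-irrefl e
      (subst (_< 2 * K + 1) (sym rank≡) (≤-<-trans rank≤ (≤-reflexive (+-comm 1 (2 * K)))))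
      where
      rank≡ : rankOfChoice (index v) (π v) r ≡ rankOf (reset v) (content r (reset v) ⊔ π v)
      rank≡ = trans (rankOfChoice-rankOf (index v) (π v) r)
        (cong (λ j → rankOf j (content r j ⊔ π v)) (index-D v∈D))
      rank≤ : rankOf (reset v) (content r (reset v) ⊔ π v) ≤ 2 * K
      rank≤ with m≤n⇒m<n∨m≡n (reset≤ v∈D)
      ... | inj₁ lt = rankOf-< _ lt
      ... | inj₂ eq rewrite eq | at-last r = ≤-reflexive (rankOf-even k (last r ⊔ π v) (good-even v∈D eq g))

    closed : ∀ s s′ → s ∈ W → T (σ s s′) → s′ ∈ W
    closed s s′ s∈W h with toWitness {a? = inW? s} s∈W | toWitness {a? = plays? s s′} h
    ... | _ , v∈D , g | pick {v} {r} valid = fromWitness {a? = inW? (pickAt v r)}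
      (pickAt-state valid , v∈D , pickAt-rank v∈D g , λ u mv →
        let mv′ , u∈D = Move-inside v∈D mv in good-step v∈D u∈D mv′ g (updated v∈D))
    ... | _ , v∈D , _ , g | step {v} {u} {r} st mv = fromWitness {a? = inW? (choose u r)}
      (proj₁ (toWitness st) , proj₂ (Move-inside v∈D mv) , g u mv)

    W⊆states : W ⊆ states
    W⊆states (choose v r) h = fromWitness (proj₁ (toWitness {a? = inW? (choose v r)} h))
    W⊆states (move v r p) h = proj₁ (toWitness {a? = inW? (move v r p)} h)

    defensive : ∀ s → s ∈ W → rank s ≢ 2 * K + 1
    defensive (choose v r) h e = contradiction (trans e (+-comm (2 * K) 1)) λ ()
    defensive (move v r p) h = proj₁ (proj₂ (proj₂ (toWitness {a? = inW? (move v r p)} h)))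

    vertexOf : State → Fin n
    vertexOf (choose v _) = v
    vertexOf (move v _ _) = v

    registersOf : State → Registers
    registersOf (choose _ r) = r
    registersOf (move _ r _) = r

    vertexOf-D : ∀ s → s ∈ W → vertexOf s ∈ D
    vertexOf-D (choose v r) h = proj₁ (proj₂ (toWitness {a? = inW? (choose v r)} h))
    vertexOf-D (move v r p) h = proj₁ (proj₂ (toWitness {a? = inW? (move v r p)} h))

    data Choosing : State → Set where
      choosing : ∀ {v r} → Choosing (choose v r)

    record Round (a b c : State) : Set where
      private
        v = vertexOf a
        r = registersOf a
      field
        ends      : Choosing c
        moves     : Move next′ v (vertexOf c)
        writes    : registersOf c ≡ update (index v) (π v) r
        pick-rank : rank a ≡ 1
        move-rank : rank b ≡ rankOfChoice (index v) (π v) r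

    round : ∀ {a b c} → Choosing a → Plays a b → Plays b c → Round a b c
    round _ (pick _) (step _ mv) = record
      { ends = choosing ; moves = mv ; writes = refl ; pick-rank = refl ; move-rank = refl }

    HasEvenMax : (ℕ → State) → Set
    HasEvenMax p = ∃[ b ] (∀ i → rank (p i) ≤ 2 * b) × ∃[ i ] rank (p i) ≡ 2 * b

    -- Picks and moves alternate, so every second state starts a round, and sampling these states
    -- turns the path into a `Trace`.
    choosing-first : ∀ (p : ℕ → State) N → (∀ t → p (t + suc N) ≡ p t) → (∀ t → p t ∈ W) →
                     (∀ t → Plays (p t) (p (suc t))) → Choosing (p 0) → HasEvenMax p
    choosing-first p N periodic p∈W plays first = from-trace (even trace obeys)
      where
      open Round
      chooses : ∀ t → Choosing (p (t * 2))
      rounds : ∀ t → Round (p (t * 2)) (p (suc (t * 2))) (p (suc t * 2))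
      chooses zero    = first
      chooses (suc t) = ends (rounds t)
      rounds t = round (chooses t) (plays (t * 2)) (plays (suc (t * 2)))
      v : ℕ → Fin n
      v t = vertexOf (p (t * 2))
      v∈D : ∀ t → v t ∈ D
      v∈D t = vertexOf-D _ (p∈W (t * 2))
      r : ℕ → Registers
      r t = registersOf (p (t * 2))
      -- `suc N` rounds take two periods of the path, so the trace can keep the same period.
      twice : ∀ t → p ((t + suc N) * 2) ≡ p (t * 2)
      twice t = trans (cong p eq) (trans (periodic _) (periodic _))
        where
        eq : (t + suc N) * 2 ≡ t * 2 + suc N + suc N
        eq = trans (*-distribʳ-+ 2 t (suc N)) (trans (cong (t * 2 +_)
          (trans (*-comm (suc N) 2) (cong (suc N +_) (+-identityʳ (suc N)))))
          (sym (+-assoc (t * 2) (suc N) (suc N))))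
      trace : Trace
      trace = record
        { period            = N
        ; vertex            = v
        ; reset             = λ t → toℕ (index (v t))
        ; register          = λ t → content (r t)
        ; vertex-periodic   = λ t → cong vertexOf (twice t)
        ; register-periodic = λ t j → cong (λ s → content (registersOf s) j) (twice t)
        ; edges             = λ t → Move.along (moves (rounds t))
        ; keeps             = λ t j lt → trans (cong (λ r → content r j) (writes (rounds t)))
                                (content-keeps {index (v t)} {π (v t)} {r t} j (π≤d (v t)) lt)
        ; assigns           = λ t j eq → trans (cong (λ r → content r (suc j)) (writes (rounds t)))
                                (content-assigns {index (v t)} {π (v t)} {r t} j eq)
        }
      obeys : Obeys D next reset trace
      obeys = record
        { inside  = v∈D
        ; follows = λ t o → Move.chosen (proj₁ (Move-inside (v∈D t) (moves (rounds t)))) o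
        ; resets  = λ t → index-D (v∈D t)
        }
      move-rank′ : ∀ t → rank (p (suc (t * 2))) ≡ Trace.rankAt trace t
      move-rank′ t = trans (move-rank (rounds t)) (rankOfChoice-rankOf (index (v t)) (π (v t)) (r t))
      from-trace : Trace.EvenMax trace → HasEvenMax p
      from-trace (b , rank≤ , t , rank≡) =
        b , even-odd (λ i → rank (p i) ≤ 2 * b) picks≤ moves≤ , suc (t * 2) , trans (move-rank′ t) rank≡
        where
        moves≤ : ∀ t → rank (p (suc (t * 2))) ≤ 2 * b
        moves≤ t = ≤-trans (≤-reflexive (move-rank′ t)) (rank≤ t)
        picks≤ : ∀ t → rank (p (t * 2)) ≤ 2 * b
        picks≤ t = ≤-trans (≤-reflexive (pick-rank (rounds t)))
          (≤-trans (1≤rankOf (Trace.reset trace t) _) (rank≤ t))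

    even-path : ∀ (p : ℕ → State) N → (∀ t → p (t + suc N) ≡ p t) → (∀ t → p t ∈ W) →
                (∀ t → Plays (p t) (p (suc t))) → HasEvenMax p
    even-path p N periodic p∈W plays = start (plays 0) refl refl
      where
      unshift : HasEvenMax (p ∘ suc) → HasEvenMax p
      unshift (b , rank≤ , i , rank≡) = b , ranks , suc i , rank≡
        where
        ranks : ∀ i → rank (p i) ≤ 2 * b
        -- The shifted path meets the first state one period later, at its index `N`.
        ranks zero    = subst (λ s → rank s ≤ 2 * b) (periodic 0) (rank≤ N)
        ranks (suc i) = rank≤ i
      start : ∀ {a b} → Plays a b → a ≡ p 0 → b ≡ p 1 → HasEvenMax p
      start (pick _)   eq _ = choosing-first p N periodic p∈W plays (subst Choosing eq choosing)
      start (step _ _) _ eq = unshift (choosing-first (p ∘ suc) N (periodic ∘ suc) (p∈W ∘ suc)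
                                                      (plays ∘ suc) (subst Choosing eq choosing))

    cycle-even : ∀ {u us} → IsCycle R steven σ W u us → parity (highest R steven (u ∷ us)) ≡ 0ℙ
    cycle-even {us = us} cycle = highest-even (even-path path (length us) path-periodic path-inside
      (λ t → toWitness {a? = plays? (path t) (path (suc t))} (path-moves t)))
      where open CyclePath cycle

    isDefensive : Nonempty D → c ≤ d → IsDefensive σ W
    isDefensive (v , v∈D) c≤d = record
      { dominion  = record
        { strategy = isStrategy
        ; traps    = record { inside = W⊆states ; nonempty = top , top∈W ; closed = closed }
        ; cycles   = λ _ _ → cycle-even
        }
      ; defensive = defensive
      }
      where
      top : State
      -- With `d` in all registers the content is even and at least `c`, hence strong; this shows
      -- that `W` is not empty.
      top = choose v (replicate K d)
      top∈W : top ∈ W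
      top∈W = fromWitness {a? = inW? top} (replicate-Valid , v∈D ,
        strong⇒good v∈D (subst (Strong c) (sym last≡) (d-even , c≤d)))
        where
        last≡ : last (replicate K d) ≡ d
        last≡ = trans (sym (at-last (replicate K d))) (at-replicate K k)
        replicate-Valid : Valid (replicate K d)
        replicate-Valid =
          mono-linked _ (λ i j _ → ≤-reflexive
            (trans (Vec.lookup-replicate i d) (sym (Vec.lookup-replicate j d)))) ,
          VecAll.lookup⁻ (λ i → ≤-reflexive (Vec.lookup-replicate i d))

    starts∈W : ∀ v r → v ∈ D → Valid r → parity (last r) ≡ 0ℙ → c ≤ last r → choose v r ∈ W
    starts∈W v r v∈D valid ev c≤ =
      fromWitness {a? = inW? (choose v r)} (valid , v∈D , strong⇒good v∈D (ev , c≤))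

-- Decidability of defensive strategies

module _ {X : Set} (xs : List X) where

  allIn? : ∀ {A B : X → Set} → (∀ x → A x → x ∈ˡ xs) → (∀ x → Dec (A x)) → (∀ x → Dec (B x)) →
           Dec (∀ x → A x → B x)
  allIn? within A? B? = map′
    (λ h x a → All.lookup h (within x a) a) (λ h → All.tabulate (λ {x} _ → h x))
    (All.all? (λ x → A? x →-dec B? x) xs)

  anyIn? : ∀ {A : X → Set} → (∀ x → A x → x ∈ˡ xs) → (∀ x → Dec (A x)) → Dec (∃[ x ] A x)
  anyIn? within A? = map′
    (λ h → let x , _ , a = find h in x , a) (λ (x , a) → lose (within x a) a)
    (Any.any? A? xs)

  listsUpTo? : ∀ N {P : List X → Set} → (∀ ys → Dec (P ys)) →
               Dec (∀ ys → length ys ≤ N → All (_∈ˡ xs) ys → P ys)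
  listsUpTo? zero P? = map′ (λ { p [] _ _ → p }) (λ h → h [] z≤n []) (P? [])
  listsUpTo? (suc N) P? = map′
    (λ { (p , h) [] _ _ → p ; (p , h) (y ∷ ys) le (y∈ ∷ ys∈) → h y y∈ ys (s≤s⁻¹ le) ys∈ })
    (λ h → h [] z≤n [] , λ y y∈ ys le ys∈ → h (y ∷ ys) (s≤s le) (y∈ ∷ ys∈))
    (P? [] ×-dec map′ (λ h y y∈ → All.lookup h y∈) (λ h → All.tabulate (λ {y} → h y))
      (All.all? (λ y → listsUpTo? N (λ ys → P? (y ∷ ys))) xs))

  lookup-injective : ∀ {ys : List X} → Unique ys → ∀ i j → List.lookup ys i ≡ List.lookup ys j → i ≡ j
  lookup-injective (_ ∷ _) zero zero _ = refl
  lookup-injective {_ ∷ ys} (y≢ ∷ _) zero (suc j) eq = contradiction eq (All.lookup y≢ (∈-lookup j))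
  lookup-injective {_ ∷ ys} (y≢ ∷ _) (suc i) zero eq = contradiction (sym eq) (All.lookup y≢ (∈-lookup i))
  lookup-injective (_ ∷ u) (suc i) (suc j) eq = cong suc (lookup-injective u i j eq)

  -- Pigeonhole: distinct entries have distinct positions in `xs`. This bounds the length of simple
  -- cycles, so that `listsUpTo?` covers them all.
  Unique⇒length≤ : ∀ {ys} → Unique ys → All (_∈ˡ xs) ys → length ys ≤ length xs
  Unique⇒length≤ {ys} u ys∈ = Fin.injective⇒≤ {f = f} λ {i} {j} eq → lookup-injective u i j
    (trans (Any.lookup-index (position i)) (trans (cong (List.lookup xs) eq) (sym (Any.lookup-index (position j)))))
    where
    position : ∀ i → List.lookup ys i ∈ˡ xs
    position i = All.lookup ys∈ (∈-lookup i)
    f : Fin (length ys) → Fin (length xs)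
    f i = Any.index (position i)

  module _ (_≟ˣ_ : DecidableEquality X) where

    -- A subset supported on xs is determined by a Boolean for each entry of xs.
    anySubsetIn? : ∀ {P : Subset X → Set} →
      (∀ {S S′} → (∀ x → S x ≡ S′ x) → P S → P S′) →
      (∀ {S} → P S → ∀ x → x ∈ S → x ∈ˡ xs) →
      (∀ S → (∀ x → x ∈ S → x ∈ˡ xs) → Dec (P S)) →
      Dec (∃[ S ] P S)
    anySubsetIn? {P} resp supported P? = map′
      (λ (b , p) → decode b , p) (λ (S , p) → encode S , resp (decode-encode S (supported p)) p)
      (Fin.anySubset? (λ b → P? (decode b) (decode⊆ b)))
      where
      Code : Set
      Code = Vec Bool (length xs)
      marked? : ∀ (b : Code) x → Dec (∃[ i ] List.lookup xs i ≡ x × T (lookup b i))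
      marked? b x = Fin.any? (λ i → (List.lookup xs i ≟ˣ x) ×-dec T? (lookup b i))
      decode : Code → Subset X
      decode b x = ⌊ marked? b x ⌋
      decode⊆ : ∀ b x → x ∈ decode b → x ∈ˡ xs
      decode⊆ b x h with toWitness {a? = marked? b x} h
      ... | i , refl , _ = ∈-lookup i
      encode : Subset X → Code
      encode S = tabulate (S ∘ List.lookup xs)
      T-≡ : ∀ {a b} → (T a → T b) → (T b → T a) → a ≡ b
      T-≡ {true}  {true}  _ _ = refl
      T-≡ {false} {false} _ _ = refl
      T-≡ {true}  {false} f _ = ⊥-elim (f tt)
      T-≡ {false} {true}  _ g = ⊥-elim (g tt)
      decode-encode : ∀ S → (∀ x → x ∈ S → x ∈ˡ xs) → ∀ x → S x ≡ decode (encode S) x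
      decode-encode S S⊆ x = T-≡
        (λ h → let x∈ = S⊆ x h ; i = Any.index x∈ ; eq = Any.lookup-index x∈ in
          fromWitness {a? = marked? (encode S) x}
            (i , sym eq , subst T (sym (Vec.lookup∘tabulate (S ∘ List.lookup xs) i)) (subst (_∈ S) eq h)))
        (λ h → unmark (toWitness {a? = marked? (encode S) x} h))
        where
        unmark : ∃[ i ] List.lookup xs i ≡ x × T (lookup (encode S) i) → x ∈ S
        unmark (i , refl , h) = subst T (Vec.lookup∘tabulate (S ∘ List.lookup xs) i) h

-- A witness below `s` replaces `s`; the fuel `N` bounds the current witness and shrinks with each
-- replacement.
least : ∀ {P : ℕ → Set} → (∀ j → Dec (P j)) → ∀ {s} → P s → ∃[ m ] Minimum P m × m ≤ s
least {P} P? {s} = below s ≤-refl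
  where
  below : ∀ N {s} → s ≤ N → P s → ∃[ m ] Minimum P m × m ≤ s
  below N {s} s≤N p with anyUpTo? P? s
  ... | no none = s , (p , λ j q → ≮⇒≥ (λ j<s → none (j , j<s , q))) , ≤-refl
  below zero {zero} s≤N p | yes (t , () , q)
  below (suc N) s≤N p | yes (t , t<s , q) =
    let m , min , m≤t = below N (s≤s⁻¹ (<-≤-trans t<s s≤N)) q in m , min , ≤-trans m≤t (<⇒≤ t<s)

module DefensiveDecidable (𝒢 : ParityGame) (D : Subset (Fin (ParityGame.n 𝒢))) (m : ℕ) where
  open ParityGame 𝒢 renaming (arena to G)
  private
    K : ℕ
    K = suc m
  open RegisterGame 𝒢 K renaming (arena to R)

  _≟ˢ_ : DecidableEquality State
  choose v r ≟ˢ choose v′ r′ = map′ (λ { (refl , refl) → refl }) (λ { refl → refl , refl })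
    ((v Fin.≟ v′) ×-dec Vec.≡-dec _≟_ r r′)
  choose _ _ ≟ˢ move _ _ _ = no λ ()
  move _ _ _ ≟ˢ choose _ _ = no λ ()
  move v r p ≟ˢ move v′ r′ p′ =
    map′ (λ { (refl , refl , refl) → refl }) (λ { refl → refl , refl , refl })
    ((v Fin.≟ v′) ×-dec (Vec.≡-dec _≟_ r r′ ×-dec (p ≟ p′)))

  vectors : ∀ l → List (Vec ℕ l)
  vectors zero    = [ [] ]
  vectors (suc l) = cartesianProductWith _∷_ (upTo (suc d)) (vectors l)

  ∈-vectors : ∀ {l} {r : Vec ℕ l} → VecAll.All (_≤ d) r → r ∈ˡ vectors l
  ∈-vectors VecAll.[]         = here refl
  ∈-vectors (x≤d VecAll.∷ r≤) = ∈-cartesianProductWith⁺ _∷_ (∈-upTo⁺ (s≤s x≤d)) (∈-vectors r≤)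

  ∈-Valid : ∀ {r} → Valid r → r ∈ˡ vectors K
  ∈-Valid (_ , r≤d) = ∈-vectors r≤d

  chooseStates moveStates stateList : List State
  chooseStates = cartesianProductWith choose (allFin n) (vectors K)
  moveStates   = cartesianProductWith (λ v (r , p) → move v r p) (allFin n)
                   (cartesianProduct (vectors K) (upTo (suc (2 * K + 1))))
  stateList    = chooseStates ++ moveStates

  ∈-stateList : ∀ s → s ∈ states → s ∈ˡ stateList
  ∈-stateList (choose v r) h =
    ∈-++⁺ˡ (∈-cartesianProductWith⁺ choose (∈-allFin v) (∈-Valid (toWitness h)))
  ∈-stateList (move v r p) h = let valid , _ , p≤ = toWitness h in
    ∈-++⁺ʳ chooseStates (∈-cartesianProductWith⁺ (λ v (r , p) → move v r p) (∈-allFin v)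
      (∈-cartesianProduct⁺ (∈-Valid valid) (∈-upTo⁺ (s≤s p≤))))

  pairList : List (State × State)
  pairList = cartesianProduct stateList stateList

  edge? : ∀ s s′ → Dec (s ⟶ s′)
  edge? (choose v r) (choose _ _) = no λ ()
  edge? (choose v r) (move v′ r′ p) = map′
    (λ { (i , refl , refl , refl) → pick v r i }) (λ { (pick _ _ i) → i , refl , refl , refl })
    (Fin.any? λ i → (v′ Fin.≟ v) ×-dec (Vec.≡-dec _≟_ r′ (update i (π v) r) ×-dec (p ≟ rankOfChoice i (π v) r)))
  edge? (move v r p) (choose u r′) = map′
    (λ { (e , refl) → step v u r p (tt , tt , e) }) (λ { (step _ _ _ _ (_ , _ , e)) → e , refl })
    (T? (edge v u) ×-dec Vec.≡-dec _≟_ r′ r)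
  edge? (move _ _ _) (move _ _ _) = no λ ()

  Edge? : ∀ s s′ → Dec (Arena.Edge R s s′)
  Edge? s s′ = T? (states s) ×-dec (T? (states s′) ×-dec edge? s s′)

  -- The strategy is taken as a set of pairs, so that `anySubsetIn?` applies to it as it does to
  -- `W`.
  record Wins (σ : Subset (State × State)) (W : Subset State) : Set where
    constructor _,_
    field
      wins   : IsDefensive (curry σ) W
      starts : ∀ v r → v ∈ D → Valid r → parity (last r) ≡ 0ℙ → (∀ u → u ∈ D → π u ≤ last r) →
               choose v r ∈ W

    open IsDominionStrategy (IsDefensive.dominion wins) public

  -- A subset decoded from its code agrees with the original pointwise, so winning has to be
  -- invariant under pointwise equality.
  Wins-resp : ∀ {σ σ′ W W′} → (∀ e → σ e ≡ σ′ e) → (∀ s → W s ≡ W′ s) → Wins σ W → Wins σ′ W′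
  Wins-resp {σ} {σ′} {W} {W′} σ≗ W≗ w = record
    { dominion = record
      { strategy = record
        { edges    = λ v u h → edges v u (σ← h)
        ; own      = λ v v∈ o → let u , h = own v v∈ o in u , σ→ h
        ; opponent = λ v u o e → σ→ (opponent v u o e)
        }
      ; traps = record
        { inside   = λ v v∈ → inside v (W← v∈)
        ; nonempty = let v , v∈ = nonempty in v , W→ v∈
        ; closed   = λ w u w∈ h → W→ (closed w u (W← w∈) (σ← h))
        }
      ; cycles = λ v vs c → cycles v vs record
        { inside = All.map W← (IsCycle.inside c)
        ; simple = IsCycle.simple c
        ; linked = Linked.map σ← (IsCycle.linked c)
        }
      }
    ; defensive = λ s s∈ → IsDefensive.defensive wins s (W← s∈)
    } , λ v r v∈ valid ev h → W→ (starts v r v∈ valid ev h)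
    where
    open Wins w
    open IsStrategy strategy
    open TrapsIn traps
    σ→ : ∀ {v u} → T (σ (v , u)) → T (σ′ (v , u))
    σ→ {v} {u} = subst T (σ≗ (v , u))
    σ← : ∀ {v u} → T (σ′ (v , u)) → T (σ (v , u))
    σ← {v} {u} = subst T (sym (σ≗ (v , u)))
    W→ : ∀ {s} → s ∈ W → s ∈ W′
    W→ {s} = subst T (W≗ s)
    W← : ∀ {s} → s ∈ W′ → s ∈ W
    W← {s} = subst T (sym (W≗ s))

  module _ (σ : Subset (State × State)) (σ⊆ : ∀ e → e ∈ σ → e ∈ˡ pairList)
           (W : Subset State) (W⊆ : ∀ s → s ∈ W → s ∈ˡ stateList) where

    σ⊆ʳ : ∀ v u → T (σ (v , u)) → u ∈ˡ stateList
    σ⊆ʳ v u h = proj₂ (∈-cartesianProduct⁻ stateList stateList (σ⊆ (v , u) h))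

    strategy? : Dec (IsStrategy R steven (curry σ))
    strategy? = map′
      (λ (e , o , p) → record
        { edges = λ v u → e (v , u) ; own = o ; opponent = λ v u ¬o h → p v (proj₁ h) u (proj₁ (proj₂ h)) ¬o h })
      (λ s → (λ (v , u) → IsStrategy.edges s v u) , IsStrategy.own s ,
        λ v _ u _ → IsStrategy.opponent s v u)
      (allIn? pairList σ⊆ (T? ∘ σ) (λ (v , u) → Edge? v u)
      ×-dec (allIn? stateList ∈-stateList (T? ∘ states) (λ v → steven? (stateOwner v) →-dec
        anyIn? stateList (σ⊆ʳ v) (λ u → T? (σ (v , u))))
      ×-dec allIn? stateList ∈-stateList (T? ∘ states) (λ v →
        allIn? stateList ∈-stateList (T? ∘ states) (λ u →
          ¬? (steven? (stateOwner v)) →-dec (Edge? v u →-dec T? (σ (v , u)))))))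

    traps? : Dec (TrapsIn R steven (curry σ) W)
    traps? = map′
      (λ (i , n , c) → record { inside = i ; nonempty = n ; closed = λ w u w∈ h → c w w∈ u h })
      (λ t → TrapsIn.inside t , TrapsIn.nonempty t , λ w w∈ u → TrapsIn.closed t w u w∈)
      (allIn? stateList W⊆ (T? ∘ W) (T? ∘ states)
      ×-dec (anyIn? stateList W⊆ (T? ∘ W)
      ×-dec allIn? stateList W⊆ (T? ∘ W) (λ w →
        allIn? stateList (σ⊆ʳ w) (λ u → T? (σ (w , u))) (T? ∘ W))))

    isCycle? : ∀ v vs → Dec (IsCycle R steven (curry σ) W v vs)
    isCycle? v vs = map′
      (λ (i , s , l) → record { inside = i ; simple = s ; linked = l })
      (λ c → IsCycle.inside c , IsCycle.simple c , IsCycle.linked c)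
      (All.all? (T? ∘ W) (v ∷ vs) ×-dec (DecUnique.unique? _≟ˢ_ (v ∷ vs) ×-dec
        Linked.linked? (λ w u → T? (σ (w , u))) (v ∷ vs ++ [ v ])))

    CyclesEven : List State → Set
    CyclesEven []       = ⊤
    CyclesEven (v ∷ vs) = IsCycle R steven (curry σ) W v vs → parity (highest R steven (v ∷ vs)) ≡ 0ℙ

    cyclesEven? : ∀ vs → Dec (CyclesEven vs)
    cyclesEven? []       = yes tt
    cyclesEven? (v ∷ vs) = isCycle? v vs →-dec (parity (highest R steven (v ∷ vs)) ℙ.≟ 0ℙ)

    cycles? : Dec (∀ v vs → IsCycle R steven (curry σ) W v vs → parity (highest R steven (v ∷ vs)) ≡ 0ℙ)
    cycles? = map′
      (λ h v vs c → h (v ∷ vs)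
        (Unique⇒length≤ stateList (IsCycle.simple c) (listed c)) (listed c) c)
      (λ { h [] _ _ → tt ; h (v ∷ vs) _ _ → h v vs })
      (listsUpTo? stateList (length stateList) cyclesEven?)
      where
      listed : ∀ {v vs} → IsCycle R steven (curry σ) W v vs → All (_∈ˡ stateList) (v ∷ vs)
      listed c = All.map (λ {s} → W⊆ s) (IsCycle.inside c)

    starts? : Dec (∀ v r → v ∈ D → Valid r → parity (last r) ≡ 0ℙ → (∀ u → u ∈ D → π u ≤ last r) →
                   choose v r ∈ W)
    starts? = map′
      (λ h v r v∈ valid → h v v∈ r valid) (λ h v v∈ r valid → h v r v∈ valid)
      (allIn? (allFin n) (λ v _ → ∈-allFin v) (T? ∘ D) λ v →
        allIn? (vectors K) (λ r → ∈-Valid) valid? λ r →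
          (parity (last r) ℙ.≟ 0ℙ) →-dec
          (allIn? (allFin n) (λ u _ → ∈-allFin u) (T? ∘ D) (λ u → π u ≤? last r) →-dec T? (W (choose v r))))

    wins? : Dec (Wins σ W)
    wins? = map′
      (λ (s , t , c , d , st) → record
        { dominion = record { strategy = s ; traps = t ; cycles = c } ; defensive = d } , st)
      (λ w → Wins.strategy w , Wins.traps w , Wins.cycles w , IsDefensive.defensive (Wins.wins w) , Wins.starts w)
      (strategy? ×-dec (traps? ×-dec (cycles? ×-dec
        (allIn? stateList W⊆ (T? ∘ W) (λ s → ¬? (rank s ≟ 2 * K + 1)) ×-dec starts?))))

  -- Strategies consist of pairs of states and dominions of states, so both searches run over
  -- finitely many candidates.
  hasDefensive? : Dec (HasDefensiveOn 𝒢 D (suc m))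
  hasDefensive? = map′
    (λ { (σ , W , wins , starts) → curry σ , W , wins , starts })
    (λ { (σ , W , wins , starts) → uncurry σ , W , (wins , starts) })
    (anySubsetIn? pairList (×-≡-dec _≟ˢ_ _≟ˢ_)
      (λ σ≗ (W , w) → W , Wins-resp σ≗ (λ _ → refl) w)
      (λ (W , w) (v , u) h → let v∈ , u∈ , _ = IsStrategy.edges (Wins.strategy w) v u h in
        ∈-cartesianProduct⁺ (∈-stateList v v∈) (∈-stateList u u∈))
      λ σ σ⊆ → anySubsetIn? stateList _≟ˢ_
        (λ W≗ → Wins-resp (λ _ → refl) W≗)
        (λ w s s∈ → ∈-stateList s (TrapsIn.inside (Wins.traps w) s s∈))
        (wins? σ σ⊆))

-- Lehtinen versus Strahler

module _ (𝒢 : ParityGame) where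
  open ParityGame 𝒢 renaming (arena to G)
  open Strategies 𝒢

  hasDefensiveOn? : ∀ D j → Dec (HasDefensiveOn 𝒢 D j)
  hasDefensiveOn? D zero    = no λ ()
  hasDefensiveOn? D (suc m) = DefensiveDecidable.hasDefensive? 𝒢 D m

  -- The vertex lies in some dominion, whose strategy contains all edges of the opponent, so the
  -- successor lies in that same dominion.
  largestDominion-closed : ∀ {P D} → IsLargestDominion G P D → ∀ {v u} →
                           v ∈ D → owner v ≢ P → T (edge v u) → u ∈ D
  largestDominion-closed largest {v} {u} v∈D ¬o e
    with D′ , (σ , dom) , v∈D′ ← Equivalence.to (largest v) v∈D =
    Equivalence.from (largest u) (D′ , (σ , dom) , u∈D′)
    where
    open IsDominionStrategy dom
    u∈D′ : u ∈ D′
    u∈D′ = TrapsIn.closed traps v u v∈D′ (IsStrategy.opponent strategy v u ¬o (tt , tt , e))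

  defensiveOn : ∀ {D d′} → IsLargestDominion G steven D → Nonempty D →
                (H : Decomposition G steven d′ D) → HasDefensiveOn 𝒢 D (strahler (tree H))
  defensiveOn {D} largest nonempty H = at-strahler (strahler (tree H)) refl (strahler≥1 (tree H))
    where
    Bound : ℕ → Set
    Bound x = ∀ u → u ∈ D → π u ≤ x
    -- The least bound is taken rather than `d`: the top register of a starting state need only
    -- bound the priorities in `D` and may hold less than `d`.
    bound : ∃[ c ] Minimum Bound c × c ≤ d
    bound = least (λ x → Fin.all? (λ u → T? (D u) →-dec (π u ≤? x))) (λ u _ → π≤d u)
    at-strahler : ∀ s → strahler (tree H) ≡ s → 1 ≤ s → HasDefensiveOn 𝒢 D s
    at-strahler (suc k) eq _ with c , (π≤c , c-least) , c≤d ← bound =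
      σ , W , isDefensive nonempty c≤d ,
      λ v r v∈D valid ev π≤last → starts∈W v r v∈D valid ev (c-least _ π≤last)
      where
      open RegisterStrategy 𝒢 k
      open Winning (fromDecomposition (π≤c _) H (≤-reflexive eq)) (largestDominion-closed largest)

lemma7 : ∀ (𝒢 : ParityGame) (s : ℕ) → IsStrahlerNumber 𝒢 s →
    ∃[ ℓ ] IsLehtinenNumber 𝒢 ℓ × ℓ ≤ s
lemma7 𝒢 s (D , _ , sˢ , sᵃ , largest , ((_ , H , refl) , _) , _ , _ , refl) with Fin.any? (λ v → T? (D v))
-- The Lehtinen number is `1` by convention, and Strahler numbers are at least `1`.
... | no empty = 1 , (D , largest , inj₁ ((λ v v∈D → empty (v , v∈D)) , refl)) ,
  ≤-trans (strahler≥1 (tree H)) (m≤m⊔n sˢ sᵃ)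
-- Steven's half of the Strahler number already has the property; by decidability the minimum exists
-- and lies below it.
... | yes nonempty
  with ℓ , min , ℓ≤ ← least (hasDefensiveOn? 𝒢 D) (defensiveOn 𝒢 largest nonempty H) =
  ℓ , (D , largest , inj₂ (nonempty , min)) , ≤-trans ℓ≤ (m≤m⊔n sˢ sᵃ)
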